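{- Let $G^\sigma$ be an oriented graph whose underlying graph $G$ is a simple connected graph with $n$ vertices and $m$ edges. Then $$sr(G^\sigma)+\alpha(G)\geqslant 4n-2m-\sqrt{n(n-1)-2m+\tfrac{1}{4}}-\tfrac{5}{2},$$ with equality if and only if $G\cong S_n$ or $G\cong C_3$.
   Context: An oriented graph $G^\sigma$ is obtained from a simple graph $G$ by assigning a direction to each edge. Its skew-adjacency matrix $S(G^\sigma)=[s_{x,y}]$ has $s_{x,y}=1$ if there is an arc from $x$ to $y$, $s_{x,y}=-1$ if there is an arc from $y$ to $x$, and $0$ otherwise; the skew-rank $sr(G^\sigma)$ is the rank of $S(G^\sigma)$. $\alpha(G)$ is the independence number of $G$. $S_n$ denotes the star on $n$ vertices (the single vertex when $n=1$) and $C_3$ the triangle. -}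

module Defs where

open import Data.Bool.Base using (if_then_else_)
open import Data.Empty using (⊥-elim)
open import Data.Fin.Base using (Fin; zero; suc)
open import Data.Fin.Properties as Fin using (all?; ¬∀⟶∃¬)
open import Data.Fin.Subset using (Subset; _∈_; _∉_; ∣_∣; inside; outside)
open import Data.Fin.Subset.Properties using (_∈?_; drop-there)
open import Data.Integer.Base using (ℤ)
open import Data.List.Base using (List; []; _∷_; _++_; map; filter; length; allFin; cartesianProduct)
open import Data.List.Extrema.Nat using (max)
open import Data.Nat.Base using (ℕ; zero; suc)
open import Data.Product using (Σ; ∃; _×_; _,_)
open import Data.Rational.Base hiding (∣_∣)
open import Data.Rational.Properties
open import Data.Rational.Solver
open import Data.Sum.Base using (_⊎_; inj₁; inj₂)
open import Data.Vec.Base using ([]; _∷_; here; there)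
open import Function.Base using (_∘_)
open import Function.Bundles using (_⇔_; _↔_; module Inverse)
open import Level using (0ℓ)
open import Relation.Binary.Construct.Closure.ReflexiveTransitive using (Star)
open import Relation.Binary.Core using (Rel)
open import Relation.Binary.Definitions using (Decidable; Symmetric; Irreflexive)
open import Relation.Binary.PropositionalEquality
open import Relation.Nullary using (¬_; yes; no; does)
open import Relation.Nullary.Decidable using (_×-dec_; _→-dec_; ¬?; map′)
open import Relation.Unary as U using (Pred)

open import Algebra.Bundles using (CommutativeRing)
open import Algebra.Properties.Semiring.Sum (CommutativeRing.semiring +-*-commutativeRing)
  using (sum; ∑-distrib-+; *-distribˡ-sum; *-distribʳ-sum; sum-cong-≗; sum-replicate-zero)

open +-*-Solver using (solve; _:=_; _:+_; _:*_; :-_; _:-_)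

private variable
  m n : ℕ

------------------------------------------------------------------------
-- Graphs

record Graph (n : ℕ) : Set₁ where
  field
    Adj        : Rel (Fin n) 0ℓ
    adj?       : Decidable Adj
    adj-sym    : Symmetric Adj
    adj-irrefl : Irreflexive _≡_ Adj

open Graph

edgeCount : Graph n → ℕ
edgeCount {n} G = length (filter (λ (x , y) → (x Fin.<? y) ×-dec adj? G x y)
                                 (cartesianProduct (allFin n) (allFin n)))

-- The null graph does not count as connected.
Connected : Graph n → Set
Connected {n} G = Fin n × (∀ x y → Star (Adj G) x y)

infix 4 _≅_
_≅_ : Graph m → Graph n → Set
_≅_ {m} {n} G H =
  Σ (Fin m ↔ Fin n) λ f → ∀ x y → Adj G x y ⇔ Adj H (Inverse.to f x) (Inverse.to f y)

data StarAdj : Rel (Fin n) 0ℓ where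
  out : (i : Fin n) → StarAdj zero (suc i)
  inn : (i : Fin n) → StarAdj (suc i) zero

-- Vertex zero is the centre.
star : (n : ℕ) → Graph n
star n = record { Adj = StarAdj ; adj? = dec ; adj-sym = symm ; adj-irrefl = irr }
  where
  dec : ∀ {n} → Decidable (StarAdj {n})
  dec zero    zero    = no λ ()
  dec zero    (suc i) = yes (out i)
  dec (suc i) zero    = yes (inn i)
  dec (suc i) (suc j) = no λ ()
  symm : ∀ {n} → Symmetric (StarAdj {n})
  symm (out i) = inn i
  symm (inn i) = out i
  irr : ∀ {n} → Irreflexive _≡_ (StarAdj {n})
  irr refl ()

C₃ : Graph 3
C₃ = record
  { Adj        = _≢_
  ; adj?       = λ x y → ¬? (x Fin.≟ y)
  ; adj-sym    = ≢-sym
  ; adj-irrefl = λ x≡y x≢y → x≢y x≡y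
  }

-- Arc x y is the arc from x to y.
record Orientation (G : Graph n) : Set₁ where
  field
    Arc     : Rel (Fin n) 0ℓ
    arc?    : Decidable Arc
    arc⇒adj : ∀ {x y} → Arc x y → Adj G x y
    adj⇒arc : ∀ {x y} → Adj G x y → Arc x y ⊎ Arc y x
    asym    : ∀ {x y} → Arc x y → ¬ Arc y x

open Orientation

------------------------------------------------------------------------
-- Largest cardinality of a subset with a given property

subsets : (n : ℕ) → List (Subset n)
subsets zero    = [] ∷ []
subsets (suc n) = map (outside ∷_) (subsets n) ++ map (inside ∷_) (subsets n)

-- Only used for properties that hold of the empty subset.
maxCard : {P : Pred (Subset n) 0ℓ} → U.Decidable P → ℕ
maxCard {n} P? = max 0 (map ∣_∣ (filter P? (subsets n)))

Independent : Graph n → Pred (Subset n) 0ℓ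
Independent G S = ∀ x y → x ∈ S → y ∈ S → ¬ Adj G x y

independent? : (G : Graph n) → U.Decidable (Independent G)
independent? G S =
  all? λ x → all? λ y → (x ∈? S) →-dec ((y ∈? S) →-dec ¬? (adj? G x y))

α : Graph n → ℕ
α G = maxCard (independent? G)

------------------------------------------------------------------------
-- Rank of a rational matrix

Matrix : ℕ → ℕ → Set
Matrix m n = Fin m → Fin n → ℚ

-- The rows with index in S are linearly independent; a linear combination of
-- them is given by coefficients on all rows that vanish outside S.
IndependentRows : Matrix m n → Pred (Subset m) 0ℓ
IndependentRows {m} A S = ∀ (c : Fin m → ℚ) →
  (∀ i → i ∉ S → c i ≡ 0ℚ) → (∀ j → sum (λ i → c i * A i j) ≡ 0ℚ) → ∀ i → c i ≡ 0ℚ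

private
  sum-zero : (f : Fin n → ℚ) → (∀ i → f i ≡ 0ℚ) → sum f ≡ 0ℚ
  sum-zero {n} f f≡0 = trans (sum-cong-≗ f≡0) (sum-replicate-zero n)

  *-cancel-0 : ∀ p q → p ≢ 0ℚ → p * q ≡ 0ℚ → q ≡ 0ℚ
  *-cancel-0 p q p≢0 pq≡0 = begin
    q                ≡⟨ *-identityˡ q ⟨
    1ℚ * q           ≡⟨ cong (_* q) (*-inverseˡ p) ⟨
    (1/ p * p) * q   ≡⟨ *-assoc (1/ p) p q ⟩
    1/ p * (p * q)   ≡⟨ cong (1/ p *_) pq≡0 ⟩
    1/ p * 0ℚ        ≡⟨ *-zeroʳ (1/ p) ⟩
    0ℚ               ∎
    where
    open ≡-Reasoning
    instance _ = ≢-nonZero p≢0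

  cons : ℚ → (Fin n → ℚ) → Fin (suc n) → ℚ
  cons q f zero    = q
  cons q f (suc i) = f i

  -- Clears column j of the rows below row zero.
  eliminate : Matrix (suc m) n → Fin n → Matrix m n
  eliminate A j i k = A zero j * A (suc i) k - A (suc i) j * A zero k

  sum-eliminate : ∀ (A : Matrix (suc m) n) j (c : Fin m → ℚ) k →
    sum (λ i → c i * eliminate A j i k) ≡
    A zero j * sum (λ i → c i * A (suc i) k) - sum (λ i → c i * A (suc i) j) * A zero k
  sum-eliminate {m} A j c k = begin
    sum (λ i → c i * eliminate A j i k)
      ≡⟨ sum-cong-≗ (λ i → solve 5 (λ c p x y z →
           c :* (p :* x :- y :* z) := p :* (c :* x) :+ (c :* y) :* (:- z)) refl
           (c i) (A zero j) (A (suc i) k) (A (suc i) j) (A zero k)) ⟩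
    sum (λ i → p * (c i * A (suc i) k) + (c i * A (suc i) j) * (- z))
      ≡⟨ ∑-distrib-+ (λ i → p * (c i * A (suc i) k)) (λ i → (c i * A (suc i) j) * (- z)) ⟩
    sum (λ i → p * (c i * A (suc i) k)) + sum (λ i → (c i * A (suc i) j) * (- z))
      ≡⟨ cong₂ _+_ (*-distribˡ-sum p (λ i → c i * A (suc i) k))
                   (*-distribʳ-sum (- z) (λ i → c i * A (suc i) j)) ⟨
    p * s + t * (- z)
      ≡⟨ cong ((p * s) +_) (neg-distribʳ-* t z) ⟨
    p * s - t * z ∎
    where
    open ≡-Reasoning
    p = A zero j
    z = A zero k
    s = sum (λ i → c i * A (suc i) k)
    t = sum (λ i → c i * A (suc i) j)

  module Pivot (A : Matrix (suc m) n) (S : Subset m) (j : Fin n) (p≢0 : A zero j ≢ 0ℚ) where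
    p = A zero j

    up : IndependentRows (eliminate A j) S → IndependentRows A (inside ∷ S)
    up ind c c∉ c0 = λ { zero → c₀≡0 ; (suc i) → c₊≡0 i }
      where
      T : Fin n → ℚ
      T k = sum (λ i → c (suc i) * A (suc i) k)
      c₊≡0 : ∀ i → c (suc i) ≡ 0ℚ
      c₊≡0 = ind (c ∘ suc) (λ i i∉ → c∉ (suc i) (i∉ ∘ drop-there)) λ k → begin
        _ ≡⟨ sum-eliminate A j (c ∘ suc) k ⟩
        p * T k - T j * A zero k
          ≡⟨ solve 5 (λ p x y z c →
               p :* x :- y :* z := p :* (c :* z :+ x) :- (c :* p :+ y) :* z) refl
               p (T k) (T j) (A zero k) (c zero) ⟩
        p * (c zero * A zero k + T k) - (c zero * p + T j) * A zero k
          ≡⟨ cong₂ (λ u v → p * u - v * A zero k) (c0 k) (c0 j) ⟩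
        p * 0ℚ - 0ℚ * A zero k
          ≡⟨ cong₂ _-_ (*-zeroʳ p) (*-zeroˡ (A zero k)) ⟩
        0ℚ ∎
        where open ≡-Reasoning
      c₀≡0 : c zero ≡ 0ℚ
      c₀≡0 = *-cancel-0 p (c zero) p≢0 (begin
        p * c zero          ≡⟨ *-comm p (c zero) ⟩
        c zero * p          ≡⟨ +-identityʳ (c zero * p) ⟨
        c zero * p + 0ℚ     ≡⟨ cong ((c zero * p) +_) (sum-zero _ (λ i →
                                 trans (cong (_* A (suc i) j) (c₊≡0 i)) (*-zeroˡ (A (suc i) j)))) ⟨
        c zero * p + T j    ≡⟨ c0 j ⟩
        0ℚ                  ∎)
        where open ≡-Reasoning

    down : IndependentRows A (inside ∷ S) → IndependentRows (eliminate A j) S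
    down ind c c∉ c0 i = *-cancel-0 p (c i) p≢0 (ind c′ c′∉ c′0 (suc i))
      where
      T : Fin n → ℚ
      T k = sum (λ i → c i * A (suc i) k)
      c′ = cons (- T j) (λ i → p * c i)
      c′∉ : ∀ i → i ∉ inside ∷ S → c′ i ≡ 0ℚ
      c′∉ zero    i∉ = ⊥-elim (i∉ here)
      c′∉ (suc i) i∉ = trans (cong (p *_) (c∉ i (i∉ ∘ there))) (*-zeroʳ p)
      c′0 : ∀ k → sum (λ i → c′ i * A i k) ≡ 0ℚ
      c′0 k = begin
        - T j * A zero k + sum (λ i → (p * c i) * A (suc i) k)
          ≡⟨ cong ((- T j * A zero k) +_) (trans
               (sum-cong-≗ (λ i → *-assoc p (c i) (A (suc i) k)))
               (sym (*-distribˡ-sum p (λ i → c i * A (suc i) k)))) ⟩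
        - T j * A zero k + p * T k
          ≡⟨ solve 4 (λ t z p s → (:- t) :* z :+ p :* s := p :* s :- t :* z) refl
               (T j) (A zero k) p (T k) ⟩
        p * T k - T j * A zero k
          ≡⟨ sum-eliminate A j c k ⟨
        sum (λ i → c i * eliminate A j i k)
          ≡⟨ c0 k ⟩
        0ℚ ∎
        where open ≡-Reasoning

independentRows? : (A : Matrix m n) → U.Decidable (IndependentRows A)
independentRows? {zero}  A []            = yes λ _ _ _ ()
independentRows? {suc m} A (outside ∷ S) = map′ to from (independentRows? (A ∘ suc) S)
  where
  to : IndependentRows (A ∘ suc) S → IndependentRows A (outside ∷ S)
  to ind c c∉ c0 = λ { zero → c₀≡0 ; (suc i) → c₊≡0 i }
    where
    c₀≡0 = c∉ zero λ ()
    c₊≡0 = ind (c ∘ suc) (λ i i∉ → c∉ (suc i) (i∉ ∘ drop-there)) λ j →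
      let T = sum (λ i → c (suc i) * A (suc i) j) in begin
      T                       ≡⟨ +-identityˡ T ⟨
      0ℚ + T                  ≡⟨ cong (_+ T) (*-zeroˡ (A zero j)) ⟨
      0ℚ * A zero j + T       ≡⟨ cong (λ z → z * A zero j + T) c₀≡0 ⟨
      c zero * A zero j + T   ≡⟨ c0 j ⟩
      0ℚ                      ∎
      where open ≡-Reasoning
  from : IndependentRows A (outside ∷ S) → IndependentRows (A ∘ suc) S
  from ind c c∉ c0 i = ind (cons 0ℚ c) c′∉ c′0 (suc i)
    where
    c′∉ : ∀ i → i ∉ outside ∷ S → cons 0ℚ c i ≡ 0ℚ
    c′∉ zero    _  = refl
    c′∉ (suc i) i∉ = c∉ i (i∉ ∘ there)
    c′0 : ∀ j → sum (λ i → cons 0ℚ c i * A i j) ≡ 0ℚ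
    c′0 j = cong₂ _+_ (*-zeroˡ (A zero j)) (c0 j)
independentRows? {suc m} {n} A (inside ∷ S) with all? (λ j → A zero j ≟ 0ℚ)
... | yes A₀≡0 = no λ ind → 1≢0 (ind e e∉ e0 zero)
  where
  e : Fin (suc m) → ℚ
  e = cons 1ℚ (λ _ → 0ℚ)
  e∉ : ∀ i → i ∉ inside ∷ S → e i ≡ 0ℚ
  e∉ zero    i∉ = ⊥-elim (i∉ here)
  e∉ (suc i) _  = refl
  e0 : ∀ j → sum (λ i → e i * A i j) ≡ 0ℚ
  e0 j = cong₂ _+_ (trans (*-identityˡ (A zero j)) (A₀≡0 j))
                   (sum-zero _ (λ i → *-zeroˡ (A (suc i) j)))
... | no A₀≢0 with ¬∀⟶∃¬ n _ (λ j → A zero j ≟ 0ℚ) A₀≢0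
...   | j , p≢0 = map′ (Pivot.up A S j p≢0) (Pivot.down A S j p≢0)
                       (independentRows? (eliminate A j) S)

rank : Matrix m n → ℕ
rank A = maxCard (independentRows? A)

skewAdjacency : {G : Graph n} → Orientation G → Matrix n n
skewAdjacency σ x y =
  if does (arc? σ x y) then 1ℚ else
  if does (arc? σ y x) then - 1ℚ else
  0ℚ

sr : {G : Graph n} → Orientation G → ℕ
sr σ = rank (skewAdjacency σ)

------------------------------------------------------------------------
-- Real numbers as two-sided Dedekind cuts

record ℝ : Set₁ where
  field
    Lower Upper     : Pred ℚ 0ℓ
    lower-inhabited : ∃ Lower
    upper-inhabited : ∃ Upper
    lower-closed    : ∀ {q r} → q < r → Lower r → Lower q
    upper-closed    : ∀ {q r} → q < r → Upper q → Upper r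
    lower-open      : ∀ {q} → Lower q → ∃ λ r → q < r × Lower r
    upper-open      : ∀ {q} → Upper q → ∃ λ r → r < q × Upper r
    disjoint        : ∀ {q} → Lower q → ¬ Upper q
    located         : ∀ {q r} → q < r → Lower q ⊎ Upper r

open ℝ

infix 4 _≤ᵣ_ _≥ᵣ_ _≃ᵣ_

_≤ᵣ_ _≥ᵣ_ _≃ᵣ_ : Rel ℝ 0ℓ
x ≤ᵣ y = ∀ q → Lower x q → Lower y q
x ≥ᵣ y = y ≤ᵣ x
x ≃ᵣ y = x ≤ᵣ y × y ≤ᵣ x

private
  x<x+1 : ∀ x → x < x + 1ℚ
  x<x+1 x = subst (_< x + 1ℚ) (+-identityʳ x) (+-monoʳ-< x (positive⁻¹ 1ℚ))

  x-1<x : ∀ x → x - 1ℚ < x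
  x-1<x x = subst (x - 1ℚ <_) (+-identityʳ x) (+-monoʳ-< x (negative⁻¹ (- 1ℚ)))

  -‿anti : ∀ a {p q} → p < q → a - q < a - p
  -‿anti a p<q = +-monoʳ-< a (neg-antimono-< p<q)

  a-[a-x] : ∀ a x → a - (a - x) ≡ x
  a-[a-x] = solve 2 (λ a x → a :- (a :- x) := x) refl

  [x+a]-a : ∀ x a → (x + a) - a ≡ x
  [x+a]-a = solve 2 (λ x a → (x :+ a) :- a := x) refl

  [x-a]+a : ∀ x a → (x - a) + a ≡ x
  [x-a]+a = solve 2 (λ x a → (x :- a) :+ a := x) refl

fromℚ : ℚ → ℝ
fromℚ x = record
  { Lower           = _< x
  ; Upper           = x <_
  ; lower-inhabited = x - 1ℚ , x-1<x x
  ; upper-inhabited = x + 1ℚ , x<x+1 x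
  ; lower-closed    = <-trans
  ; upper-closed    = λ q<r x<q → <-trans x<q q<r
  ; lower-open      = λ q<x → let r , q<r , r<x = <-dense q<x in r , q<r , r<x
  ; upper-open      = λ x<q → let r , x<r , r<q = <-dense x<q in r , r<q , x<r
  ; disjoint        = <-asym
  ; located         = loc
  }
  where
  loc : ∀ {q r} → q < r → q < x ⊎ x < r
  loc {q} q<r with q <? x
  ... | yes q<x = inj₁ q<x
  ... | no  q≮x = inj₂ (≤-<-trans (≮⇒≥ q≮x) q<r)

infixl 6 _⊖_ _⊝_

-- a ⊖ x is the real number a - x, for rational a.
_⊖_ : ℚ → ℝ → ℝ
a ⊖ x = record
  { Lower           = λ q → Upper x (a - q)
  ; Upper           = λ q → Lower x (a - q)
  ; lower-inhabited = let u , xu = upper-inhabited x in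
                      a - u , subst (Upper x) (eq u) xu
  ; upper-inhabited = let l , xl = lower-inhabited x in
                      a - l , subst (Lower x) (eq l) xl
  ; lower-closed    = λ q<r → upper-closed x (-‿anti a q<r)
  ; upper-closed    = λ q<r → lower-closed x (-‿anti a q<r)
  ; lower-open      = λ {q} xq → let r , r<a-q , xr = upper-open x xq in
                      a - r , subst (_< a - r) (a-[a-x] a q) (-‿anti a r<a-q)
                            , subst (Upper x) (eq r) xr
  ; upper-open      = λ {q} xq → let r , a-q<r , xr = lower-open x xq in
                      a - r , subst (a - r <_) (a-[a-x] a q) (-‿anti a a-q<r)
                            , subst (Lower x) (eq r) xr
  ; disjoint        = λ u l → disjoint x l u
  ; located         = loc
  }
  where
  eq : ∀ u → u ≡ a - (a - u)
  eq u = sym (a-[a-x] a u)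
  loc : ∀ {q r} → q < r → Upper x (a - q) ⊎ Lower x (a - r)
  loc q<r with located x (-‿anti a q<r)
  ... | inj₁ l = inj₂ l
  ... | inj₂ u = inj₁ u

-- x ⊝ b is the real number x - b, for rational b.
_⊝_ : ℝ → ℚ → ℝ
x ⊝ b = record
  { Lower           = λ q → Lower x (q + b)
  ; Upper           = λ q → Upper x (q + b)
  ; lower-inhabited = let l , xl = lower-inhabited x in l - b , subst (Lower x) (eq l) xl
  ; upper-inhabited = let u , xu = upper-inhabited x in u - b , subst (Upper x) (eq u) xu
  ; lower-closed    = λ q<r → lower-closed x (+-monoˡ-< b q<r)
  ; upper-closed    = λ q<r → upper-closed x (+-monoˡ-< b q<r)
  ; lower-open      = λ {q} xq → let r , q+b<r , xr = lower-open x xq in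
                      r - b , subst (_< r - b) ([x+a]-a q b) (+-monoˡ-< (- b) q+b<r)
                            , subst (Lower x) (eq r) xr
  ; upper-open      = λ {q} xq → let r , r<q+b , xr = upper-open x xq in
                      r - b , subst (r - b <_) ([x+a]-a q b) (+-monoˡ-< (- b) r<q+b)
                            , subst (Upper x) (eq r) xr
  ; disjoint        = disjoint x
  ; located         = λ q<r → located x (+-monoˡ-< b q<r)
  }
  where
  eq : ∀ u → u ≡ (u - b) + b
  eq u = sym ([x-a]+a u b)

private
  module Sqrt (d : ℚ) where
    L U : Pred ℚ 0ℓ
    L q = q < 0ℚ ⊎ q * q < d
    U q = 0ℚ < q × d < q * q

    0<*0< : ∀ {x y} → 0ℚ < x → 0ℚ < y → 0ℚ < x * y
    0<*0< {x} {y} 0<x 0<y =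
      subst (_< x * y) (*-zeroʳ x) (*-monoʳ-<-pos x {{positive 0<x}} 0<y)

    sq-≤ : ∀ {q r} → 0ℚ ≤ q → q ≤ r → q * q ≤ r * r
    sq-≤ {q} {r} 0≤q q≤r = ≤-trans
      (*-monoˡ-≤-nonNeg q {{nonNegative 0≤q}} q≤r)
      (*-monoʳ-≤-nonNeg r {{nonNegative (≤-trans 0≤q q≤r)}} q≤r)

    sq-< : ∀ {q r} → 0ℚ ≤ q → q < r → q * q < r * r
    sq-< {q} {r} 0≤q q<r = ≤-<-trans
      (*-monoˡ-≤-nonNeg q {{nonNegative 0≤q}} (<⇒≤ q<r))
      (*-monoˡ-<-pos r {{positive (≤-<-trans 0≤q q<r)}} q<r)

    0≤sq : ∀ {q} → 0ℚ < q → 0ℚ ≤ q * q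
    0≤sq 0<q = <⇒≤ (0<*0< 0<q 0<q)

    <⇒0<- : ∀ {x y} → x < y → 0ℚ < y - x
    <⇒0<- {x} {y} x<y = subst (_< y - x) (+-inverseʳ x) (+-monoˡ-< (- x) x<y)

    0<-⇒< : ∀ {x y} → 0ℚ < y - x → x < y
    0<-⇒< {x} {y} h = subst₂ _<_ (+-identityˡ x) ([x-a]+a y x) (+-monoˡ-< x h)

    -- For 0 ≤ q the next approximation q′ = (c q + d) / (q + c), where
    -- c = d + 1, lies strictly between q and the square root of d.
    module Step (q : ℚ) (0≤d : 0ℚ ≤ d) (0≤q : 0ℚ ≤ q) where
      c s e q′ : ℚ
      c = d + 1ℚ
      s = q + c

      0<c : 0ℚ < c
      0<c = ≤-<-trans 0≤d (x<x+1 d)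

      0<s : 0ℚ < s
      0<s = +-mono-≤-< 0≤q 0<c

      instance
        s-pos : Positive s
        s-pos = positive 0<s
        s-nz : NonZero s
        s-nz = pos⇒nonZero s

      e  = (d - q * q) * 1/ s
      q′ = q + e

      es : e * s ≡ d - q * q
      es = begin
        ((d - q * q) * 1/ s) * s ≡⟨ *-assoc (d - q * q) (1/ s) s ⟩
        (d - q * q) * (1/ s * s) ≡⟨ cong ((d - q * q) *_) (*-inverseˡ s) ⟩
        (d - q * q) * 1ℚ         ≡⟨ *-identityʳ _ ⟩
        d - q * q                ∎
        where open ≡-Reasoning

      cancel-s : ∀ {x} → 0ℚ < x * s → 0ℚ < x
      cancel-s {x} h = *-cancelʳ-<-nonNeg s {{pos⇒nonNeg s}}
                         (subst (_< x * s) (sym (*-zeroˡ s)) h)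

      gap : (c - q′) * s ≡ c * c - d
      gap = begin
        (c - (q + e)) * s           ≡⟨ solve 4 (λ c q e s → (c :- (q :+ e)) :* s := c :* s :- q :* s :- e :* s) refl c q e s ⟩
        c * s - q * s - e * s       ≡⟨ cong (λ z → c * s - q * s - z) es ⟩
        c * s - q * s - (d - q * q) ≡⟨ solve 3 (λ c q d → c :* (q :+ c) :- q :* (q :+ c) :- (d :- q :* q) := c :* c :- d) refl c q d ⟩
        c * c - d                   ∎
        where open ≡-Reasoning

      0<c-q′ : 0ℚ < c - q′
      0<c-q′ = cancel-s (subst (0ℚ <_) (sym gap) (<⇒0<- d<cc))
        where
        1≤c : 1ℚ ≤ c
        1≤c = +-monoˡ-≤ 1ℚ 0≤d
        d<cc : d < c * c
        d<cc = <-≤-trans (x<x+1 d) (subst (_≤ c * c) (*-identityʳ c)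
                 (*-monoˡ-≤-nonNeg c {{nonNegative (<⇒≤ 0<c)}} 1≤c))

      defect : d - q′ * q′ ≡ e * (c - q′)
      defect = begin
        d - (q + e) * (q + e)
          ≡⟨ solve 3 (λ d q e → d :- (q :+ e) :* (q :+ e) := (d :- q :* q) :- e :* (q :+ q :+ e)) refl d q e ⟩
        (d - q * q) - e * (q + q + e)
          ≡⟨ cong (_- (e * (q + q + e))) es ⟨
        e * s - e * (q + q + e)
          ≡⟨ solve 3 (λ e q c → e :* (q :+ c) :- e :* (q :+ q :+ e) := e :* (c :- (q :+ e))) refl e q c ⟩
        e * (c - q′) ∎
        where open ≡-Reasoning

      lower : q * q < d → q < q′ × q′ * q′ < d
      lower qq<d = subst (_< q′) (+-identityʳ q) (+-monoʳ-< q 0<e)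
                 , 0<-⇒< (subst (0ℚ <_) (sym defect) (0<*0< 0<e 0<c-q′))
        where
        0<e : 0ℚ < e
        0<e = cancel-s (subst (0ℚ <_) (sym es) (<⇒0<- qq<d))

      upper : 0ℚ < q → d < q * q → q′ < q × 0ℚ < q′ × d < q′ * q′
      upper 0<q d<qq = q′<q , 0<q′ , 0<-⇒< (subst (0ℚ <_) eq (0<*0< 0<-e 0<c-q′))
        where
        neg-es : (- e) * s ≡ q * q - d
        neg-es = trans (sym (neg-distribˡ-* e s))
                (trans (cong -_ es) (solve 2 (λ d x → :- (d :- x) := x :- d) refl d (q * q)))
        0<-e : 0ℚ < - e
        0<-e = cancel-s (subst (0ℚ <_) (sym neg-es) (<⇒0<- d<qq))
        q′<q : q′ < q
        q′<q = 0<-⇒< (subst (0ℚ <_) (solve 2 (λ q e → :- e := q :- (q :+ e)) refl q e) 0<-e)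
        q′s : q′ * s ≡ q * c + d
        q′s = trans (*-distribʳ-+ s q e) (trans (cong ((q * s) +_) es)
              (solve 3 (λ q c d → q :* (q :+ c) :+ (d :- q :* q) := q :* c :+ d) refl q c d))
        0<q′ : 0ℚ < q′
        0<q′ = cancel-s (subst (0ℚ <_) (sym q′s)
                 (+-mono-<-≤ (0<*0< 0<q 0<c) 0≤d))
        eq : (- e) * (c - q′) ≡ q′ * q′ - d
        eq = trans (sym (neg-distribˡ-* e (c - q′)))
            (trans (cong -_ (sym defect))
            (solve 2 (λ d x → :- (d :- x) := x :- d) refl d (q′ * q′)))

    L-open : ∀ {q} → L q → ∃ λ r → q < r × L r
    L-open (inj₁ q<0) = let r , q<r , r<0 = <-dense q<0 in r , q<r , inj₁ r<0
    L-open {q} (inj₂ qq<d) with q <? 0ℚ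
    ... | yes q<0 = let r , q<r , r<0 = <-dense q<0 in r , q<r , inj₁ r<0
    ... | no  q≮0 = let 0≤q = ≮⇒≥ q≮0
                        0≤d = <⇒≤ (≤-<-trans (sq-≤ ≤-refl 0≤q) qq<d)
                        q<q′ , h = Step.lower q 0≤d 0≤q qq<d
                    in Step.q′ q 0≤d 0≤q , q<q′ , inj₂ h

    U-open : ∀ {q} → U q → ∃ λ r → r < q × U r
    U-open {q} (0<q , d<qq) with d <? 0ℚ
    ... | yes d<0 = let r , 0<r , r<q = <-dense 0<q in
                    r , r<q , 0<r , <-≤-trans d<0 (0≤sq 0<r)
    ... | no  d≮0 = let 0≤d = ≮⇒≥ d≮0
                        q′<q , 0<q′ , h = Step.upper q 0≤d (<⇒≤ 0<q) 0<q d<qq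
                    in Step.q′ q 0≤d (<⇒≤ 0<q) , q′<q , 0<q′ , h

    L-closed : ∀ {q r} → q < r → L r → L q
    L-closed q<r (inj₁ r<0) = inj₁ (<-trans q<r r<0)
    L-closed {q} q<r (inj₂ rr<d) with q <? 0ℚ
    ... | yes q<0 = inj₁ q<0
    ... | no  q≮0 = inj₂ (<-trans (sq-< (≮⇒≥ q≮0) q<r) rr<d)

    U-closed : ∀ {q r} → q < r → U q → U r
    U-closed q<r (0<q , d<qq) = <-trans 0<q q<r , <-trans d<qq (sq-< (<⇒≤ 0<q) q<r)

    LU-disjoint : ∀ {q} → L q → ¬ U q
    LU-disjoint (inj₁ q<0)  (0<q , _)  = <-asym q<0 0<q
    LU-disjoint (inj₂ qq<d) (_ , d<qq) = <-asym qq<d d<qq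

    LU-located : ∀ {q r} → q < r → L q ⊎ U r
    LU-located {q} q<r with q <? 0ℚ | q * q <? d
    ... | yes q<0 | _        = inj₁ (inj₁ q<0)
    ... | no  _   | yes qq<d = inj₁ (inj₂ qq<d)
    ... | no  q≮0 | no  qq≮d = inj₂ (≤-<-trans 0≤q q<r , ≤-<-trans (≮⇒≥ qq≮d) (sq-< 0≤q q<r))
      where 0≤q = ≮⇒≥ q≮0

    U-inhabited : ∃ U
    U-inhabited with d <? 1ℚ
    ... | yes d<1 = 1ℚ , positive⁻¹ 1ℚ , d<1
    ... | no  d≮1 = d + 1ℚ , 0<c , <-≤-trans (x<x+1 d) (subst (_≤ (d + 1ℚ) * (d + 1ℚ)) (*-identityʳ (d + 1ℚ))
                      (*-monoˡ-≤-nonNeg (d + 1ℚ) {{nonNegative (<⇒≤ 0<c)}} 1≤c))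
      where
      1≤c : 1ℚ ≤ d + 1ℚ
      1≤c = ≤-trans (≮⇒≥ d≮1) (<⇒≤ (x<x+1 d))
      0<c : 0ℚ < d + 1ℚ
      0<c = <-≤-trans (positive⁻¹ 1ℚ) 1≤c

-- The square root of a negative rational is 0.
√ : ℚ → ℝ
√ d = record
  { Lower           = λ q → q < 0ℚ ⊎ q * q < d
  ; Upper           = λ q → 0ℚ < q × d < q * q
  ; lower-inhabited = - 1ℚ , inj₁ (negative⁻¹ (- 1ℚ))
  ; upper-inhabited = U-inhabited
  ; lower-closed    = L-closed
  ; upper-closed    = U-closed
  ; lower-open      = L-open
  ; upper-open      = U-open
  ; disjoint        = LU-disjoint
  ; located         = LU-located
  }
  where open Sqrt d

fromℤ : ℤ → ℚ
fromℤ i = i / 1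

{-# OPTIONS --safe #-}

-- Write d = m - n + 1.  Two bounds are combined.
--
-- First, sr + 2α ≥ 2n - 2d.  List the vertices so that each but the first has
-- an earlier neighbour, and delete those with at least two of them: at most d
-- vertices go, since each costs an edge beyond a spanning tree, and every
-- remaining vertex has at most one earlier neighbour.  From this forest,
-- repeatedly take the last vertex v, put it into an independent set, and remove
-- it together with its only neighbour p if there is one; the rows of all pairs
-- v, p are linearly independent.
--
-- Second, an independent set of size α leaves m ≤ n(n-1)/2 - α(α-1)/2, that is
-- (α - 1/2)² ≤ n(n-1) - 2m + 1/4, with equality exactly when G is the join of a
-- clique and α isolated vertices.
--
-- If both are equalities and k = n - α, then sr + k² + 2kα + 2 = 5k + 2α, and
-- since a graph with an edge has positive skew-rank this leaves k ≤ 1 (a star)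
-- or k = 2, α = 1 (a triangle).
module Submission where

open import Defs
open import Algebra.Bundles using (CommutativeRing)
open import Data.Bool.Base using (true; false; if_then_else_)
open import Data.Empty using (⊥-elim)
open import Data.Fin.Base using (Fin; zero; suc)
import Data.Fin.Base as Fin using (_<_)
import Data.Fin.Properties as Fin
open import Data.Fin.Permutation using (↔⇒≡; transpose)
open import Data.Fin.Subset using (Subset; inside; outside; ⊥; ⊤; ∁; ⁅_⁆) renaming (_∈_ to _∈ₛ_; _∉_ to _∉ₛ_; ∣_∣ to ∣_∣ₛ)
open import Data.Fin.Subset.Properties using (∣⊥∣≡0; ∉⊥; ∣p∣≤n; ∣p∣≡n⇒p≡⊤; ∈⊤; x∈⁅x⁆; x∈⁅y⁆⇒x≡y; x∈∁p⇒x∉p; x∉p⇒x∈∁p; ∣⁅x⁆∣≡1; ∣∁p∣≡n∸∣p∣) renaming (_∈?_ to _∈ₛ?_)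
open import Data.List.Base using (List; []; _∷_; _++_; map; filter; length; allFin; cartesianProduct)
open import Data.List.Extrema.Nat using (max≤v⁺; xs≤max; argmax-sel)
open import Data.List.Membership.Propositional using (_∈_; _∉_; find; lose)
open import Data.List.Membership.Propositional.Properties using (∈-allFin; ∈-filter⁺; ∈-filter⁻; ∈-map⁺; ∈-map⁻; ∈-++⁺ˡ; ∈-++⁺ʳ)
open import Data.List.Membership.Propositional.Properties.WithK using (unique∧set⇒bag)
open import Data.List.Properties using (map-tabulate; map-++; map-∘; length-tabulate; length-filter)
open import Data.List.Relation.Binary.BagAndSetEquality using (∼bag⇒↭)
open import Data.List.Relation.Binary.Permutation.Propositional using (_↭_)
open import Data.List.Relation.Binary.Permutation.Propositional.Properties using (map⁺; ↭-length)
open import Data.List.Relation.Unary.All as All using (All; []; _∷_)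
open import Data.List.Relation.Unary.All.Properties using (¬Any⇒All¬; All¬⇒¬Any)
open import Data.List.Relation.Unary.AllPairs using ([]; _∷_)
open import Data.List.Relation.Unary.Any using (here; there; any?)
open import Data.List.Relation.Unary.Unique.Propositional using (Unique)
open import Data.List.Relation.Unary.Unique.Propositional.Properties using (allFin⁺)
open import Data.Nat.Base as ℕ using (ℕ; zero; suc)
import Data.Nat.Properties as ℕ
open import Data.Product.Base using (_×_; _,_; proj₁; proj₂; ∃)
open import Data.Sum.Base using (_⊎_; inj₁; inj₂)
open import Data.Vec.Base using ([]; _∷_; here; there; _[_]≔_)
open import Function.Base using (_∘_; id)
open import Function.Bundles using (_⇔_; _↔_; mk⇔; module Equivalence; module Injection; module Inverse)
open import Function.Construct.Identity using (↔-id)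
open import Function.Properties.Equivalence using () renaming (trans to ⇔-trans; sym to ⇔-sym)
open import Function.Properties.Inverse using (Inverse⇒Injection)
open import Level using (0ℓ)
open import Relation.Binary.Construct.Closure.ReflexiveTransitive using (Star; ε; _◅_)
open import Relation.Binary.Definitions using (tri<; tri≈; tri>)
open import Relation.Binary.PropositionalEquality
open import Relation.Nullary using (¬_; Dec; yes; no; does; contradiction)
open import Relation.Nullary.Decidable using (_×-dec_; dec-true; dec-false; ¬?)
import Relation.Unary as U

-- Sums over lists and double counting.

module Counting where

  open import Data.Nat.Base using (_+_; _*_; _≤_; z≤n)
  open import Data.Nat.ListAction using (sum)
  open import Data.Nat.ListAction.Properties using (sum-↭; sum-++)
  open import Data.Nat.Properties
  open import Algebra.Properties.CommutativeSemigroup +-commutativeSemigroup using (interchange)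
  open Graph

  private variable
    A B : Set
    n : ℕ
    xs ys : List A
    f g : A → ℕ

  ∑ : List A → (A → ℕ) → ℕ
  ∑ xs f = sum (map f xs)

  ∑-cong : (xs : List A) → (∀ x → f x ≡ g x) → ∑ xs f ≡ ∑ xs g
  ∑-cong []       f≡g = refl
  ∑-cong (x ∷ xs) f≡g = cong₂ _+_ (f≡g x) (∑-cong xs f≡g)

  ∑-+ : (xs : List A) (f g : A → ℕ) → ∑ xs (λ x → f x + g x) ≡ ∑ xs f + ∑ xs g
  ∑-+ []       f g = refl
  ∑-+ (x ∷ xs) f g = trans (cong (f x + g x +_) (∑-+ xs f g)) (interchange (f x) (g x) (∑ xs f) (∑ xs g))

  ∑-*ˡ : (xs : List A) (k : ℕ) (f : A → ℕ) → ∑ xs (λ x → k * f x) ≡ k * ∑ xs f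
  ∑-*ˡ []       k f = sym (*-zeroʳ k)
  ∑-*ˡ (x ∷ xs) k f = trans (cong (k * f x +_) (∑-*ˡ xs k f)) (sym (*-distribˡ-+ k (f x) (∑ xs f)))

  ∑-*ʳ : (xs : List A) (f : A → ℕ) (k : ℕ) → ∑ xs (λ x → f x * k) ≡ ∑ xs f * k
  ∑-*ʳ xs f k = trans (∑-cong xs (λ x → *-comm (f x) k)) (trans (∑-*ˡ xs k f) (*-comm k (∑ xs f)))

  ∑-const : (xs : List A) (k : ℕ) → ∑ xs (λ _ → k) ≡ length xs * k
  ∑-const []       k = refl
  ∑-const (x ∷ xs) k = cong (k +_) (∑-const xs k)

  ∑-swap : (xs : List A) (ys : List B) (f : A → B → ℕ) →
           ∑ xs (λ x → ∑ ys (f x)) ≡ ∑ ys (λ y → ∑ xs (λ x → f x y))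
  ∑-swap []       ys f = sym (trans (∑-const ys 0) (*-zeroʳ (length ys)))
  ∑-swap (x ∷ xs) ys f = trans (cong (∑ ys (f x) +_) (∑-swap xs ys f))
                               (sym (∑-+ ys (f x) (λ y → ∑ xs (λ x → f x y))))

  ∑-mono : (xs : List A) → (∀ x → f x ≤ g x) → ∑ xs f ≤ ∑ xs g
  ∑-mono []       f≤g = z≤n
  ∑-mono (x ∷ xs) f≤g = +-mono-≤ (f≤g x) (∑-mono xs f≤g)

  -- Cancelling the bounds on all other terms from the reversed inequality of the totals leaves the
  -- reversed inequality at `x`. This is how equality in a counting bound is turned into pointwise
  -- information.
  ∑-tight : {x : A} (xs : List A) → (∀ x → f x ≤ g x) → ∑ xs g ≤ ∑ xs f → x ∈ xs → f x ≡ g x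
  ∑-tight {f = f} {g = g} (y ∷ xs) f≤g G≤F (here refl) = ≤-antisym (f≤g y)
    (+-cancelʳ-≤ (∑ xs f) (g y) (f y) (≤-trans (+-monoʳ-≤ (g y) (∑-mono xs f≤g)) G≤F))
  ∑-tight {f = f} {g = g} (y ∷ xs) f≤g G≤F (there x∈) = ∑-tight xs f≤g
    (+-cancelˡ-≤ (f y) (∑ xs g) (∑ xs f) (≤-trans (+-monoˡ-≤ (∑ xs g) (f≤g y)) G≤F)) x∈

  ∑-↭ : (f : A → ℕ) → xs ↭ ys → ∑ xs f ≡ ∑ ys f
  ∑-↭ f xs↭ys = sum-↭ (map⁺ f xs↭ys)

  ∑-++ : (xs ys : List A) (f : A → ℕ) → ∑ (xs ++ ys) f ≡ ∑ xs f + ∑ ys f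
  ∑-++ xs ys f = trans (cong sum (map-++ f xs ys)) (sum-++ (map f xs) (map f ys))

  ∑-member : {x : A} (f : A → ℕ) → x ∈ xs → f x ≤ ∑ xs f
  ∑-member f (here refl) = m≤m+n _ _
  ∑-member f (there x∈)  = ≤-trans (∑-member f x∈) (m≤n+m _ _)

  -- Distinct members occupy distinct positions, so no term is used twice even if the list has
  -- repetitions.
  ∑-members : {x y : A} (f : A → ℕ) → x ∈ xs → y ∈ xs → x ≢ y → f x + f y ≤ ∑ xs f
  ∑-members f (here refl) (here refl) x≢y = contradiction refl x≢y
  ∑-members f (here refl) (there y∈)  x≢y = +-monoʳ-≤ _ (∑-member f y∈)
  ∑-members {x = x} {y} f (there x∈) (here refl) x≢y =
    ≤-trans (≤-reflexive (+-comm (f x) (f y))) (+-monoʳ-≤ (f y) (∑-member f x∈))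
  ∑-members f (there x∈)  (there y∈)  x≢y = ≤-trans (∑-members f x∈ y∈ x≢y) (m≤n+m _ _)

  ∑-allFin-suc : (f : Fin (suc n) → ℕ) → ∑ (allFin (suc n)) f ≡ f zero + ∑ (allFin n) (f ∘ suc)
  ∑-allFin-suc f = cong (λ l → f zero + sum l) (trans (map-tabulate suc f) (sym (map-tabulate id (f ∘ suc))))

  -- Iverson bracket.
  ⟦_⟧ : {P : Set} → Dec P → ℕ
  ⟦ d ⟧ = if does d then 1 else 0

  ⟦⟧-yes : {P : Set} (d : Dec P) → P → ⟦ d ⟧ ≡ 1
  ⟦⟧-yes d p rewrite dec-true d p = refl

  ⟦⟧-no : {P : Set} (d : Dec P) → ¬ P → ⟦ d ⟧ ≡ 0
  ⟦⟧-no d ¬p rewrite dec-false d ¬p = refl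

  δ : Fin n → Fin n → ℕ
  δ x y = ⟦ x Fin.≟ y ⟧

  δ-refl : (x : Fin n) → δ x x ≡ 1
  δ-refl x = ⟦⟧-yes (x Fin.≟ x) refl

  δ-≢ : {x y : Fin n} → x ≢ y → δ x y ≡ 0
  δ-≢ = ⟦⟧-no (_ Fin.≟ _)

  ∑-δ : (x : Fin n) → ∑ (allFin n) (δ x) ≡ 1
  ∑-δ {suc n} zero = trans (∑-allFin-suc {n} (δ zero))
    (cong suc (trans (∑-const (allFin n) 0) (*-zeroʳ (length (allFin n)))))
  ∑-δ {suc n} (suc x) = trans (∑-allFin-suc {n} (δ (suc x)))
    (trans (∑-cong (allFin n) eq) (∑-δ x))
    where
    eq : ∀ y → δ (suc x) (suc y) ≡ δ x y
    eq y with x Fin.≟ y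
    ... | yes _ = refl
    ... | no _  = refl

  ∑-δʳ : (x : Fin n) → ∑ (allFin n) (λ y → δ y x) ≡ 1
  ∑-δʳ {n} x = trans (∑-cong (allFin n) eq) (∑-δ x)
    where
    eq : ∀ y → δ y x ≡ δ x y
    eq y with x Fin.≟ y
    ... | yes refl = δ-refl x
    ... | no x≢y   = δ-≢ (x≢y ∘ sym)

  χ : Subset n → Fin n → ℕ
  χ S x = ⟦ x ∈ₛ? S ⟧

  ∑-χ : (S : Subset n) → ∑ (allFin n) (χ S) ≡ ∣ S ∣ₛ
  ∑-χ [] = refl
  ∑-χ {suc n} (outside ∷ S) = trans (∑-allFin-suc {n} (χ (outside ∷ S)))
    (trans (∑-cong (allFin n) (λ _ → refl)) (∑-χ S))
  ∑-χ {suc n} (inside  ∷ S) = trans (∑-allFin-suc {n} (χ (inside ∷ S)))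
    (cong suc (trans (∑-cong (allFin n) (λ _ → refl)) (∑-χ S)))

  ∑-allFin-1 : ∑ (allFin n) (λ _ → 1) ≡ n
  ∑-allFin-1 {n} = trans (∑-const (allFin n) 1) (trans (*-identityʳ _) (length-tabulate {n = n} id))

  -- Duplicate-free lists with the same members agree as bags. It replaces an order of discovery by
  -- the standard enumeration.
  unique-complete⇒↭allFin : {vs : List (Fin n)} → Unique vs → (∀ x → x ∈ vs) → vs ↭ allFin n
  unique-complete⇒↭allFin {n} vs! vs∋ =
    ∼bag⇒↭ (unique∧set⇒bag vs! (allFin⁺ n) (λ {x} → mk⇔ (λ _ → ∈-allFin x) (λ _ → vs∋ x)))

  length-filter-∑ : {P : U.Pred A 0ℓ} (P? : U.Decidable P) (xs : List A) →
                    length (filter P? xs) ≡ ∑ xs (λ x → ⟦ P? x ⟧)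
  length-filter-∑ P? [] = refl
  length-filter-∑ P? (x ∷ xs) with P? x
  ... | yes _ = cong suc (length-filter-∑ P? xs)
  ... | no _  = length-filter-∑ P? xs

  ∑-cartesianProduct : (xs : List A) (ys : List B) (f : A × B → ℕ) →
    ∑ (cartesianProduct xs ys) f ≡ ∑ xs (λ x → ∑ ys (λ y → f (x , y)))
  ∑-cartesianProduct []       ys f = refl
  ∑-cartesianProduct (x ∷ xs) ys f = trans
    (∑-++ (map (x ,_) ys) (cartesianProduct xs ys) f)
    (cong₂ _+_ (cong sum (sym (map-∘ ys))) (∑-cartesianProduct xs ys f))

  -- Ordered pairs of adjacent vertices.

  adj : Graph n → Fin n → Fin n → ℕ
  adj G x y = ⟦ adj? G x y ⟧

  adj-comm : (G : Graph n) → ∀ x y → adj G x y ≡ adj G y x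
  adj-comm G x y with adj? G y x
  ... | yes yx = ⟦⟧-yes (adj? G x y) (adj-sym G yx)
  ... | no ¬yx = ⟦⟧-no (adj? G x y) (¬yx ∘ adj-sym G)

  adj-self : (G : Graph n) → ∀ x → adj G x x ≡ 0
  adj-self G x = ⟦⟧-no (adj? G x x) (adj-irrefl G refl)

  -- Ordered pairs count each edge twice, but make the value independent of the order of the list.
  adjacentPairs : Graph n → List (Fin n) → ℕ
  adjacentPairs G vs = ∑ vs (λ x → ∑ vs (adj G x))

  -- The row and the column of `v` contribute equally by symmetry, and the diagonal entry is zero.
  adjacentPairs-∷ : (G : Graph n) → ∀ v vs →
    adjacentPairs G (v ∷ vs) ≡ 2 * ∑ vs (adj G v) + adjacentPairs G vs
  adjacentPairs-∷ G v vs = begin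
    adj G v v + d + ∑ vs (λ x → adj G x v + ∑ vs (adj G x))
      ≡⟨ cong₂ (λ a b → a + d + b) (adj-self G v) (∑-+ vs (λ x → adj G x v) (λ x → ∑ vs (adj G x))) ⟩
    d + (∑ vs (λ x → adj G x v) + adjacentPairs G vs)
      ≡⟨ cong (λ a → d + (a + adjacentPairs G vs)) (∑-cong vs (λ x → adj-comm G x v)) ⟩
    d + (d + adjacentPairs G vs)
      ≡⟨ +-assoc d d _ ⟨
    d + d + adjacentPairs G vs
      ≡⟨ cong (λ z → d + z + adjacentPairs G vs) (+-identityʳ d) ⟨
    2 * d + adjacentPairs G vs ∎
    where
    open ≡-Reasoning
    d = ∑ vs (adj G v)

  adjacentPairs-↭ : (G : Graph n) {vs ws : List (Fin n)} → vs ↭ ws →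
                    adjacentPairs G vs ≡ adjacentPairs G ws
  adjacentPairs-↭ G {vs} p = trans (∑-cong vs (λ x → ∑-↭ (adj G x) p)) (∑-↭ _ p)

  -- One copy of `edgeCount` counts the pairs with x < y, the other, after swapping the summations,
  -- those with y < x; the diagonal contributes nothing.
  2*edgeCount : (G : Graph n) → 2 * edgeCount G ≡ adjacentPairs G (allFin n)
  2*edgeCount {n} G = begin
    2 * edgeCount G
      ≡⟨ cong (edgeCount G +_) (+-identityʳ (edgeCount G)) ⟩
    edgeCount G + edgeCount G
      ≡⟨ cong₂ _+_ count (trans count (∑-swap V V up)) ⟩
    ∑ V (λ x → ∑ V (up x)) + ∑ V (λ x → ∑ V (λ y → up y x))
      ≡⟨ ∑-+ V _ _ ⟨
    ∑ V (λ x → ∑ V (up x) + ∑ V (λ y → up y x))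
      ≡⟨ ∑-cong V (λ x → trans (sym (∑-+ V _ _)) (∑-cong V (split x))) ⟩
    adjacentPairs G V ∎
    where
    open ≡-Reasoning
    V = allFin n
    up : Fin n → Fin n → ℕ
    up x y = ⟦ (x Fin.<? y) ×-dec adj? G x y ⟧
    count : edgeCount G ≡ ∑ V (λ x → ∑ V (up x))
    count = trans (length-filter-∑ _ (cartesianProduct V V)) (∑-cartesianProduct V V _)
    up-< : ∀ {x y} → x Fin.< y → up x y ≡ adj G x y
    up-< {x} {y} x<y rewrite dec-true (x Fin.<? y) x<y = refl
    up-≮ : ∀ {x y} → ¬ x Fin.< y → up x y ≡ 0
    up-≮ {x} {y} x≮y = ⟦⟧-no ((x Fin.<? y) ×-dec adj? G x y) (x≮y ∘ proj₁)
    split : ∀ x y → up x y + up y x ≡ adj G x y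
    split x y with Fin.<-cmp x y
    ... | tri< x<y _ y≮x    = trans (cong₂ _+_ (up-< x<y) (up-≮ y≮x)) (+-identityʳ _)
    ... | tri≈ x≮x refl _   = trans (cong₂ _+_ (up-≮ x≮x) (up-≮ x≮x)) (sym (adj-self G x))
    ... | tri> x≮y _ y<x    = trans (cong₂ _+_ (up-≮ x≮y) (up-< y<x)) (adj-comm G y x)

open Counting

-- Maximum cardinalities, and subsets built from lists.

module Cardinality where

  open import Data.Nat.Base using (_≤_; z≤n)

  private variable
    n : ℕ

  ∈-subsets : (S : Subset n) → S ∈ subsets n
  ∈-subsets []                    = here refl
  ∈-subsets {suc n} (outside ∷ S) = ∈-++⁺ˡ (∈-map⁺ (outside ∷_) (∈-subsets S))
  ∈-subsets {suc n} (inside  ∷ S) = ∈-++⁺ʳ (map (outside ∷_) (subsets n)) (∈-map⁺ (inside ∷_) (∈-subsets S))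

  module _ {P : U.Pred (Subset n) 0ℓ} (P? : U.Decidable P) where

    card≤maxCard : ∀ S → P S → ∣ S ∣ₛ ≤ maxCard P?
    card≤maxCard S PS = All.lookup (xs≤max 0 _) (∈-map⁺ ∣_∣ₛ (∈-filter⁺ P? (∈-subsets S) PS))

    maxCard≤ : ∀ {k} → (∀ S → P S → ∣ S ∣ₛ ≤ k) → maxCard P? ≤ k
    maxCard≤ {k} bound = max≤v⁺ z≤n (All.tabulate λ c∈ →
      let S , S∈ , eq = ∈-map⁻ ∣_∣ₛ c∈ in
      subst (_≤ k) (sym eq) (bound S (proj₂ (∈-filter⁻ P? {xs = subsets n} S∈))))

    maxCard-attained : P ⊥ → ∃ λ S → P S × ∣ S ∣ₛ ≡ maxCard P?
    maxCard-attained P⊥ with argmax-sel id 0 (map ∣_∣ₛ (filter P? (subsets n)))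
    -- The maximum may be its default value 0, which the empty set attains.
    ... | inj₁ ≡0 = ⊥ , P⊥ , trans (∣⊥∣≡0 n) (sym ≡0)
    ... | inj₂ c∈ = let S , S∈ , eq = ∈-map⁻ ∣_∣ₛ c∈ in
                    S , proj₂ (∈-filter⁻ P? {xs = subsets n} S∈) , sym eq

  ∈-insert⁻ : ∀ {x y} (S : Subset n) → y ∈ₛ S [ x ]≔ inside → y ≡ x ⊎ y ∈ₛ S
  ∈-insert⁻ {x = zero}  (s ∷ S) here       = inj₁ refl
  ∈-insert⁻ {x = zero}  (s ∷ S) (there y∈) = inj₂ (there y∈)
  ∈-insert⁻ {x = suc x} (s ∷ S) here       = inj₂ here
  ∈-insert⁻ {x = suc x} (s ∷ S) (there y∈) with ∈-insert⁻ S y∈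
  ... | inj₁ refl = inj₁ refl
  ... | inj₂ y∈S  = inj₂ (there y∈S)

  ∣insert∣ : ∀ {x} (S : Subset n) → x ∉ₛ S → ∣ S [ x ]≔ inside ∣ₛ ≡ suc ∣ S ∣ₛ
  ∣insert∣ {x = zero}  (outside ∷ S) x∉ = refl
  ∣insert∣ {x = zero}  (inside  ∷ S) x∉ = contradiction here x∉
  ∣insert∣ {x = suc x} (outside ∷ S) x∉ = ∣insert∣ S (x∉ ∘ there)
  ∣insert∣ {x = suc x} (inside  ∷ S) x∉ = cong suc (∣insert∣ S (x∉ ∘ there))

  -- Bridge from lists built by recursion to the subsets over which `α` and `rank` are maximised.
  -- The inclusion suffices, since independence of vertices or rows passes to smaller sets.
  fromUnique : {xs : List (Fin n)} → Unique xs →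
               ∃ λ S → ∣ S ∣ₛ ≡ length xs × (∀ {x} → x ∈ₛ S → x ∈ xs)
  fromUnique {n} [] = ⊥ , ∣⊥∣≡0 n , λ x∈ → ⊥-elim (∉⊥ x∈)
  fromUnique {n} {x ∷ xs} (x∉xs ∷ xs!) with fromUnique xs!
  ... | S , ∣S∣ , S⊆ = S [ x ]≔ inside
                     , trans (∣insert∣ S (All¬⇒¬Any x∉xs ∘ S⊆)) (cong suc ∣S∣)
                     , λ y∈ → member (∈-insert⁻ S y∈)
    where
    member : ∀ {y} → y ≡ x ⊎ y ∈ₛ S → y ∈ x ∷ xs
    member (inj₁ refl) = here refl
    member (inj₂ y∈S)  = there (S⊆ y∈S)

open Cardinality

-- Rational sums and independent rows of the skew-adjacency matrix.

module LinearAlgebra where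

  open import Data.Rational.Base using (ℚ; 0ℚ; 1ℚ; _+_; _*_; -_; 1/_; ≢-nonZero)
  open import Data.Rational.Properties
  open import Algebra.Properties.Semiring.Sum (CommutativeRing.semiring +-*-commutativeRing) using (sum; sum-cong-≗; sum-replicate-zero; ∑-distrib-+)
  open Graph
  open Orientation

  private variable
    n : ℕ

  sum-zero : (f : Fin n → ℚ) → (∀ i → f i ≡ 0ℚ) → sum f ≡ 0ℚ
  sum-zero {n} f f≡0 = trans (sum-cong-≗ f≡0) (sum-replicate-zero n)

  sum-single : (f : Fin n → ℚ) (p : Fin n) → (∀ i → i ≢ p → f i ≡ 0ℚ) → sum f ≡ f p
  sum-single f zero    f≡0 = trans (cong (f zero +_) (sum-zero (f ∘ suc) (λ i → f≡0 (suc i) λ ()))) (+-identityʳ (f zero))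
  sum-single f (suc p) f≡0 = trans
    (cong₂ _+_ (f≡0 zero λ ()) (sum-single (f ∘ suc) p (λ i i≢p → f≡0 (suc i) (i≢p ∘ Fin.suc-injective))))
    (+-identityˡ (f (suc p)))

  -- `f` splits into `g`, supported at `x`, and `h`, which vanishes at `x` and is supported at `y`.
  sum-pair : (f : Fin n → ℚ) {x y : Fin n} → x ≢ y → (∀ i → i ≢ x → i ≢ y → f i ≡ 0ℚ) → sum f ≡ f x + f y
  sum-pair f {x} {y} x≢y f≡0 = begin
    sum f                    ≡⟨ sum-cong-≗ split ⟩
    sum (λ i → g i + h i)    ≡⟨ ∑-distrib-+ g h ⟩
    sum g + sum h            ≡⟨ cong₂ _+_ (sum-single g x g≡0) (sum-single h y h≡0) ⟩
    g x + h y                ≡⟨ cong₂ _+_ gx hy ⟩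
    f x + f y                ∎
    where
    open ≡-Reasoning
    g h : Fin _ → ℚ
    g i = if does (i Fin.≟ x) then f i else 0ℚ
    h i = if does (i Fin.≟ x) then 0ℚ else f i
    split : ∀ i → f i ≡ g i + h i
    split i with does (i Fin.≟ x)
    ... | true  = sym (+-identityʳ (f i))
    ... | false = sym (+-identityˡ (f i))
    g≡0 : ∀ i → i ≢ x → g i ≡ 0ℚ
    g≡0 i i≢x rewrite dec-false (i Fin.≟ x) i≢x = refl
    gx : g x ≡ f x
    gx rewrite dec-true (x Fin.≟ x) refl = refl
    hy : h y ≡ f y
    hy rewrite dec-false (y Fin.≟ x) (x≢y ∘ sym) = refl
    h≡0 : ∀ i → i ≢ y → h i ≡ 0ℚ
    h≡0 i i≢y with i Fin.≟ x
    ... | yes _  = refl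
    ... | no i≢x = f≡0 i i≢x i≢y

  *≡0⇒≡0 : ∀ p q → q ≢ 0ℚ → p * q ≡ 0ℚ → p ≡ 0ℚ
  *≡0⇒≡0 p q q≢0 pq≡0 = begin
    p              ≡⟨ *-identityʳ p ⟨
    p * 1ℚ         ≡⟨ cong (p *_) (*-inverseʳ q) ⟨
    p * (q * 1/ q) ≡⟨ *-assoc p q (1/ q) ⟨
    (p * q) * 1/ q ≡⟨ cong (_* 1/ q) pq≡0 ⟩
    0ℚ * 1/ q      ≡⟨ *-zeroˡ (1/ q) ⟩
    0ℚ             ∎
    where
    open ≡-Reasoning
    instance _ = ≢-nonZero q≢0

  module _ {G : Graph n} (σ : Orientation G) where

    private
      S : Matrix n n
      S = skewAdjacency σ

    skew-nonadj : ∀ {x y} → ¬ Adj G x y → S x y ≡ 0ℚ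
    skew-nonadj {x} {y} ¬xy
      rewrite dec-false (arc? σ x y) (¬xy ∘ arc⇒adj σ)
            | dec-false (arc? σ y x) (¬xy ∘ adj-sym G ∘ arc⇒adj σ) = refl

    skew-adj : ∀ {x y} → Adj G x y → S x y ≢ 0ℚ
    skew-adj {x} {y} xy with arc? σ x y | arc? σ y x
    ... | yes _  | _      = λ ()
    ... | no _   | yes _  = λ ()
    ... | no ¬xy | no ¬yx with adj⇒arc σ xy
    ...   | inj₁ xy′ = contradiction xy′ ¬xy
    ...   | inj₂ yx  = contradiction yx ¬yx

    skew-antisym : ∀ x y → S y x ≡ - S x y
    skew-antisym x y with arc? σ x y | arc? σ y x
    ... | yes xy | yes yx = contradiction yx (asym σ xy)
    ... | yes _  | no _   = refl
    ... | no _   | yes _  = refl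
    ... | no _   | no _   = refl

    -- The columns are restricted to W so that the claim can be proved by
    -- removing vertices from W.
    RowsIndependentOn : List (Fin n) → List (Fin n) → Set
    RowsIndependentOn R W = ∀ (c : Fin n → ℚ) → (∀ i → i ∉ R → c i ≡ 0ℚ) →
      (∀ {j} → j ∈ W → sum (λ i → c i * S i j) ≡ 0ℚ) → ∀ i → c i ≡ 0ℚ

    rowsIndependent-∷ : ∀ {R W} v → RowsIndependentOn R W → RowsIndependentOn R (v ∷ W)
    rowsIndependent-∷ v ind c c∉ c0 = ind c c∉ (c0 ∘ there)

    -- Column `y` reads off the only coefficient, that of `x`. It serves to show that an edge forces
    -- positive skew-rank.
    singleRow : ∀ {x y} → Adj G x y → RowsIndependentOn (x ∷ []) (y ∷ [])
    singleRow {x} {y} xy c c∉ c0 i with i Fin.≟ x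
    ... | no i≢x   = c∉ i λ { (here i≡x) → i≢x i≡x }
    ... | yes refl = *≡0⇒≡0 (c i) (S i y) (skew-adj xy) (trans
      (sym (sum-single _ i λ j j≢i → trans (cong (_* S j y) (c∉ j λ { (here j≡i) → j≢i j≡i })) (*-zeroˡ (S j y))))
      (c0 (here refl)))

    -- Column v isolates c p; the columns in W do not involve v, so all other
    -- coefficients but c v vanish; finally column p isolates c v.
    rowsIndependent-pair : ∀ {R W W′} v p → Adj G v p → p ∈ W →
      (∀ {x} → x ∈ W → Adj G v x → x ≡ p) →
      (∀ {x} → x ∈ W′ → x ∈ W × x ≢ p) → (∀ {x} → x ∈ R → x ∈ W′) → v ∉ R →
      RowsIndependentOn R W′ → RowsIndependentOn (v ∷ p ∷ R) (v ∷ W)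
    rowsIndependent-pair {R} {W} {W′} v p vp p∈W only W′⊆ R⊆ v∉R ind c c∉ c0 = c≡0
      where
      outside-R : ∀ i → i ≢ v → i ≢ p → i ∉ R → c i ≡ 0ℚ
      outside-R i i≢v i≢p i∉R = c∉ i λ { (here i≡v) → i≢v i≡v
                                       ; (there (here i≡p)) → i≢p i≡p
                                       ; (there (there i∈R)) → i∉R i∈R }

      term-v : ∀ i → i ≢ p → c i * S i v ≡ 0ℚ
      term-v i i≢p with adj? G i v
      ... | no ¬iv = trans (cong (c i *_) (skew-nonadj ¬iv)) (*-zeroʳ (c i))
      ... | yes iv = trans (cong (_* S i v) (outside-R i
              (λ { refl → adj-irrefl G refl iv }) i≢p
              (λ i∈R → i≢p (only (proj₁ (W′⊆ (R⊆ i∈R))) (adj-sym G iv))))) (*-zeroˡ (S i v))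

      cp≡0 : c p ≡ 0ℚ
      cp≡0 = *≡0⇒≡0 (c p) (S p v) (skew-adj (adj-sym G vp))
        (trans (sym (sum-single _ p term-v)) (c0 (here refl)))

      -- The hypothesis `ind` wants coefficients supported on `R`, so the one of `v` is cleared; the
      -- one of `p` is zero already. Columns in `W′` do not notice, as `p`, the only neighbour of
      -- `v` in `W`, is not in `W′`.
      c′ : Fin n → ℚ
      c′ i with i Fin.≟ v
      ... | yes _ = 0ℚ
      ... | no _  = c i

      c′-≢ : ∀ i → i ≢ v → c′ i ≡ c i
      c′-≢ i i≢v with i Fin.≟ v
      ... | yes i≡v = contradiction i≡v i≢v
      ... | no _    = refl

      c′∉ : ∀ i → i ∉ R → c′ i ≡ 0ℚ
      c′∉ i i∉R with i Fin.≟ v | i Fin.≟ p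
      ... | yes _  | _        = refl
      ... | no _   | yes refl = cp≡0
      ... | no i≢v | no i≢p   = outside-R i i≢v i≢p i∉R

      term-W′ : ∀ {j} → j ∈ W′ → ∀ i → c′ i * S i j ≡ c i * S i j
      term-W′ {j} j∈ i with i Fin.≟ v
      ... | no _     = refl
      ... | yes refl = begin
        0ℚ * S v j ≡⟨ *-zeroˡ (S v j) ⟩
        0ℚ         ≡⟨ *-zeroʳ (c v) ⟨
        c v * 0ℚ   ≡⟨ cong (c v *_) (skew-nonadj λ vj → proj₂ (W′⊆ j∈) (only (proj₁ (W′⊆ j∈)) vj)) ⟨
        c v * S v j ∎
        where open ≡-Reasoning

      c≡0-≢ : ∀ i → i ≢ v → c i ≡ 0ℚ
      c≡0-≢ i i≢v = trans (sym (c′-≢ i i≢v)) (ind c′ c′∉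
        (λ j∈ → trans (sum-cong-≗ (term-W′ j∈)) (c0 (there (proj₁ (W′⊆ j∈))))) i)

      cv≡0 : c v ≡ 0ℚ
      cv≡0 = *≡0⇒≡0 (c v) (S v p) (skew-adj vp) (trans
        (sym (sum-single _ v (λ i i≢v → trans (cong (_* S i p) (c≡0-≢ i i≢v)) (*-zeroˡ (S i p)))))
        (c0 (there p∈W)))

      c≡0 : ∀ i → c i ≡ 0ℚ
      c≡0 i with i Fin.≟ v
      ... | yes refl = cv≡0
      ... | no i≢v   = c≡0-≢ i i≢v

    -- A combination that vanishes in every column vanishes in those of `W`, so independence on `W`
    -- is the stronger property.
    rowsIndependent⇒≤sr : ∀ {R W} → Unique R → RowsIndependentOn R W → length R ℕ.≤ sr σ
    rowsIndependent⇒≤sr R! ind = let T , ∣T∣ , T⊆ = fromUnique R! in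
      subst (ℕ._≤ sr σ) ∣T∣ (card≤maxCard (independentRows? S) T
        λ c c∉ c0 → ind c (λ i i∉ → c∉ i (i∉ ∘ T⊆)) (λ {j} _ → c0 j))

open LinearAlgebra

-- The first bound: forests and leaf removal.

module Forests where

  open import Data.Nat.Base using (_+_; _*_; _≤_; z≤n; s≤s)
  open import Data.Nat.Properties
  open import Data.Nat.Tactic.RingSolver using (solve-∀)
  open Graph

  private variable
    n : ℕ

  module _ (G : Graph n) where

    -- An acyclic induced subgraph, encoded by an order in which each vertex has at most one
    -- neighbour in the tail after it. The head therefore has degree at most one within the whole
    -- list.
    data Forest : List (Fin n) → Set where
      []  : Forest []
      add : ∀ {v vs} → v ∉ vs →
            (∀ {x y} → x ∈ vs → y ∈ vs → Adj G v x → Adj G v y → x ≡ y) →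
            Forest vs → Forest (v ∷ vs)


  private variable
    G : Graph n
    vs : List (Fin n)

  forest⇒unique : Forest G vs → Unique vs
  forest⇒unique []            = []
  forest⇒unique (add v∉ _ F) = ¬Any⇒All¬ _ v∉ ∷ forest⇒unique F

  remove : Fin n → List (Fin n) → List (Fin n)
  remove p = filter (λ x → ¬? (x Fin.≟ p))

  ∈-remove⁻ : ∀ {p x} {vs : List (Fin n)} → x ∈ remove p vs → x ∈ vs × x ≢ p
  ∈-remove⁻ {p = p} = ∈-filter⁻ (λ x → ¬? (x Fin.≟ p))

  remove-forest : ∀ p → Forest G vs → Forest G (remove p vs)
  remove-forest p [] = []
  remove-forest p (add {v} v∉ only F) with v Fin.≟ p
  ... | yes _ = remove-forest p F
  ... | no _  = add (v∉ ∘ proj₁ ∘ ∈-remove⁻)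
                    (λ x∈ y∈ → only (proj₁ (∈-remove⁻ x∈)) (proj₁ (∈-remove⁻ y∈)))
                    (remove-forest p F)

  -- Without duplicates, `p` is lost at most once.
  length-remove : ∀ p {vs : List (Fin n)} → Unique vs → length vs ≤ suc (length (remove p vs))
  length-remove p [] = z≤n
  length-remove p {v ∷ vs} (v∉ ∷ vs!) with v Fin.≟ p
  ... | no _     = s≤s (length-remove p vs!)
  ... | yes refl = s≤s (≤-reflexive (sym (all vs v∉)))
    where
    all : ∀ vs → All (v ≢_) vs → length (remove v vs) ≡ length vs
    all []       []         = refl
    all (w ∷ ws) (v≢w ∷ ps) with w Fin.≟ v
    ... | yes w≡v = contradiction (sym w≡v) v≢w
    ... | no _    = cong suc (all ws ps)

  -- Outcome of leaf removal on `W`. In `size`, an isolated vertex adds 2 to both sides; a leaf with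
  -- its neighbour adds at most 4 on the left and, through two rows and one independent vertex, 4 on
  -- the right.
  record Selection {G : Graph n} (σ : Orientation G) (W : List (Fin n)) : Set where
    field
      indep rows  : List (Fin n)
      indep!      : Unique indep
      rows!       : Unique rows
      indep⊆      : ∀ {x} → x ∈ indep → x ∈ W
      rows⊆       : ∀ {x} → x ∈ rows → x ∈ W
      independent : ∀ {x y} → x ∈ indep → y ∈ indep → ¬ Adj G x y
      independentRows : RowsIndependentOn σ rows W
      size        : 2 * length W ≤ length rows + 2 * length indep

  -- The recursion runs on the length bound `k`, because the forest on `remove p vs` is not a
  -- subterm of the given one.
  select : {G : Graph n} (σ : Orientation G) → ∀ k {W} → length W ≤ k → Forest G W → Selection σ W
  select σ k _ [] = record
    { indep = [] ; rows = [] ; indep! = [] ; rows! = [] ; indep⊆ = id ; rows⊆ = id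
    ; independent = λ () ; independentRows = λ c c∉ _ i → c∉ i (λ ()) ; size = z≤n }
  select {G = G} σ (suc k) (s≤s len) (add {v} {vs} v∉ only F) with any? (λ x → adj? G v x) vs
  ... | no isolated = record
    { indep = v ∷ indep
    ; rows = rows
    ; indep! = ¬Any⇒All¬ _ (v∉ ∘ indep⊆) ∷ indep!
    ; rows! = rows!
    ; indep⊆ = λ { (here x≡v) → here x≡v ; (there x∈) → there (indep⊆ x∈) }
    ; rows⊆ = there ∘ rows⊆
    ; independent = λ
        { (here refl) (here refl) → adj-irrefl G refl
        ; (here refl) (there y∈)  → nbr (indep⊆ y∈)
        ; (there x∈)  (here refl) → nbr (indep⊆ x∈) ∘ adj-sym G
        ; (there x∈)  (there y∈)  → independent x∈ y∈ }
    ; independentRows = rowsIndependent-∷ σ v independentRows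
    ; size = begin
        2 * suc (length vs)                       ≡⟨ *-suc 2 (length vs) ⟩
        2 + 2 * length vs                         ≤⟨ +-monoʳ-≤ 2 size ⟩
        2 + (length rows + 2 * length indep)      ≡⟨ lemma (length rows) (length indep) ⟩
        length rows + 2 * suc (length indep)      ∎
    }
    where
    open Selection (select σ k len F)
    open ≤-Reasoning
    nbr : ∀ {x} → x ∈ vs → ¬ Adj G v x
    nbr x∈ vx = isolated (lose x∈ vx)
    lemma : ∀ r i → 2 + (r + 2 * i) ≡ r + 2 * suc i
    lemma = solve-∀
  ... | yes someNbr with find someNbr
  ...   | p , p∈ , vp = record
    { indep = v ∷ indep
    ; rows = v ∷ p ∷ rows
    ; indep! = ¬Any⇒All¬ _ (v∉ ∘ inVs ∘ indep⊆) ∷ indep!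
    ; rows! = (v≢p ∷ ¬Any⇒All¬ _ (v∉ ∘ inVs ∘ rows⊆))
            ∷ ¬Any⇒All¬ _ (λ p∈R → proj₂ (∈-remove⁻ {vs = vs} (rows⊆ p∈R)) refl) ∷ rows!
    ; indep⊆ = λ { (here x≡v) → here x≡v ; (there x∈) → there (inVs (indep⊆ x∈)) }
    ; rows⊆ = λ { (here x≡v) → here x≡v
                ; (there (here refl)) → there p∈
                ; (there (there x∈)) → there (inVs (rows⊆ x∈)) }
    ; independent = λ
        { (here refl) (here refl) → adj-irrefl G refl
        ; (here refl) (there y∈)  → nbr (indep⊆ y∈)
        ; (there x∈)  (here refl) → nbr (indep⊆ x∈) ∘ adj-sym G
        ; (there x∈)  (there y∈)  → independent x∈ y∈ }
    ; independentRows = rowsIndependent-pair σ v p vp p∈ (λ x∈ vx → only x∈ p∈ vx vp)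
        (∈-remove⁻ {vs = vs}) rows⊆ (v∉ ∘ inVs ∘ rows⊆) independentRows
    ; size = begin
        2 * suc (length vs)                        ≤⟨ *-monoʳ-≤ 2 (s≤s (length-remove p (forest⇒unique F))) ⟩
        2 * (2 + length (remove p vs))             ≡⟨ *-distribˡ-+ 2 2 (length (remove p vs)) ⟩
        4 + 2 * length (remove p vs)               ≤⟨ +-monoʳ-≤ 4 size ⟩
        4 + (length rows + 2 * length indep)       ≡⟨ lemma (length rows) (length indep) ⟩
        2 + length rows + 2 * suc (length indep)   ∎
    }
    where
    open Selection (select σ k (≤-trans (length-filter _ vs) len) (remove-forest p F))
    open ≤-Reasoning
    inVs : ∀ {x} → x ∈ remove p vs → x ∈ vs
    inVs = proj₁ ∘ ∈-remove⁻
    v≢p : v ≢ p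
    v≢p refl = v∉ p∈
    nbr : ∀ {x} → x ∈ remove p vs → ¬ Adj G v x
    nbr x∈ vx = proj₂ (∈-remove⁻ {vs = vs} x∈) (only (inVs x∈) p∈ vx vp)
    lemma : ∀ r i → 4 + (r + 2 * i) ≡ 2 + r + 2 * suc i
    lemma = solve-∀

  forest-bound : {G : Graph n} (σ : Orientation G) {W : List (Fin n)} → Forest G W →
                 2 * length W ≤ sr σ + 2 * α G
  forest-bound {G = G} σ {W} F = ≤-trans size (+-mono-≤
    (rowsIndependent⇒≤sr σ rows! independentRows)
    (*-monoʳ-≤ 2 (subst (_≤ α G) ∣I∣ (card≤maxCard (independent? G) I
      λ x y x∈ y∈ → independent (I⊆ x∈) (I⊆ y∈)))))
    where
    open Selection (select σ (length W) ≤-refl F)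
    I = proj₁ (fromUnique indep!)
    ∣I∣ = proj₁ (proj₂ (fromUnique indep!))
    I⊆ = proj₂ (proj₂ (fromUnique indep!))

  -- Each visited vertex but the first has an earlier neighbour; the kept ones
  -- have exactly one, so every vertex not kept costs an extra edge.
  record Exploration (G : Graph n) : Set where
    field
      visited kept : List (Fin n)
      visited!     : Unique visited
      kept⊆        : ∀ {x} → x ∈ kept → x ∈ visited
      forest       : Forest G kept
      balance      : 4 * length visited ≤ 2 * length kept + adjacentPairs G visited + 2

  open Exploration

  -- Halved and rearranged, `balance` bounds the number of vertices not kept by edges minus vertices
  -- plus one in the visited subgraph. For a single vertex both numbers are 0.
  start : (G : Graph n) → Fin n → Exploration G
  start G x = record
    { visited = x ∷ [] ; kept = x ∷ [] ; visited! = [] ∷ [] ; kept⊆ = id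
    ; forest = add (λ ()) (λ ()) [] ; balance = +-monoˡ-≤ 2 (m≤m+n 2 (adjacentPairs G (x ∷ []))) }

  -- If `x` is the only visited neighbour of `y`, then `y` is kept: its kept neighbours are visited,
  -- so there is at most one. Otherwise `y` is not kept, and the edge to a second neighbour `w`
  -- makes up for this in `balance`.
  visit : {G : Graph n} (s : Exploration G) {x y : Fin n} → x ∈ visited s → y ∉ visited s → Adj G y x →
          ∃ λ (t : Exploration G) → visited t ≡ y ∷ visited s
  visit {G = G} s {x} {y} x∈ y∉ yx with any? (λ w → adj? G y w ×-dec ¬? (w Fin.≟ x)) (visited s)
  ... | no single = record
    { visited = y ∷ visited s ; kept = y ∷ kept s
    ; visited! = ¬Any⇒All¬ _ y∉ ∷ visited! s
    ; kept⊆ = λ { (here p) → here p ; (there p) → there (kept⊆ s p) }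
    ; forest = add (y∉ ∘ kept⊆ s) (λ w∈ z∈ yw yz → trans (≡x (kept⊆ s w∈) yw) (sym (≡x (kept⊆ s z∈) yz))) (forest s)
    ; balance = begin
        4 * suc V                   ≡⟨ *-suc 4 V ⟩
        4 + 4 * V                   ≤⟨ +-monoʳ-≤ 4 (balance s) ⟩
        4 + (2 * K + E + 2)         ≡⟨ lemma K E ⟩
        2 * suc K + (2 * 1 + E) + 2 ≤⟨ +-monoˡ-≤ 2 (+-monoʳ-≤ (2 * suc K) (+-monoˡ-≤ E (*-monoʳ-≤ 2 deg≥1))) ⟩
        2 * suc K + (2 * ∑ (visited s) (adj G y) + E) + 2
          ≡⟨ cong (λ e → 2 * suc K + e + 2) (adjacentPairs-∷ G y (visited s)) ⟨
        2 * suc K + adjacentPairs G (y ∷ visited s) + 2 ∎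
    } , refl
    where
    open ≤-Reasoning
    V = length (visited s)
    K = length (kept s)
    E = adjacentPairs G (visited s)
    ≡x : ∀ {w} → w ∈ visited s → Adj G y w → w ≡ x
    ≡x {w} w∈ yw with w Fin.≟ x
    ... | yes w≡x = w≡x
    ... | no w≢x  = contradiction (lose w∈ (yw , w≢x)) single
    deg≥1 : 1 ≤ ∑ (visited s) (adj G y)
    deg≥1 = ≤-trans (≤-reflexive (sym (⟦⟧-yes (adj? G y x) yx))) (∑-member (adj G y) x∈)
    lemma : ∀ k e → 4 + (2 * k + e + 2) ≡ 2 * suc k + (2 * 1 + e) + 2
    lemma = solve-∀
  ... | yes another with find another
  ...   | w , w∈ , yw , w≢x = record
    { visited = y ∷ visited s ; kept = kept s
    ; visited! = ¬Any⇒All¬ _ y∉ ∷ visited! s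
    ; kept⊆ = there ∘ kept⊆ s
    ; forest = forest s
    ; balance = begin
        4 * suc V                 ≡⟨ *-suc 4 V ⟩
        4 + 4 * V                 ≤⟨ +-monoʳ-≤ 4 (balance s) ⟩
        4 + (2 * K + E + 2)       ≡⟨ lemma K E ⟩
        2 * K + (2 * 2 + E) + 2   ≤⟨ +-monoˡ-≤ 2 (+-monoʳ-≤ (2 * K) (+-monoˡ-≤ E (*-monoʳ-≤ 2 deg≥2))) ⟩
        2 * K + (2 * ∑ (visited s) (adj G y) + E) + 2
          ≡⟨ cong (λ e → 2 * K + e + 2) (adjacentPairs-∷ G y (visited s)) ⟨
        2 * K + adjacentPairs G (y ∷ visited s) + 2 ∎
    } , refl
    where
    open ≤-Reasoning
    V = length (visited s)
    K = length (kept s)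
    E = adjacentPairs G (visited s)
    deg≥2 : 2 ≤ ∑ (visited s) (adj G y)
    deg≥2 = ≤-trans (≤-reflexive (cong₂ _+_ (sym (⟦⟧-yes (adj? G y w) yw)) (sym (⟦⟧-yes (adj? G y x) yx))))
                    (∑-members (adj G y) w∈ x∈ w≢x)
    lemma : ∀ k e → 4 + (2 * k + e + 2) ≡ 2 * k + (2 * 2 + e) + 2
    lemma = solve-∀

  -- Follows the path and visits whatever is new; the visited set only grows, so targets reached
  -- before are not lost.
  reach : {G : Graph n} (s : Exploration G) {x y : Fin n} → x ∈ visited s → Star (Adj G) x y →
          ∃ λ (t : Exploration G) → (∀ {z} → z ∈ visited s → z ∈ visited t) × y ∈ visited t
  reach s x∈ ε = s , id , x∈
  reach {G = G} s x∈ (_◅_ {j = z} xz path) with any? (z Fin.≟_) (visited s)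
  ... | yes z∈ = reach s z∈ path
  ... | no z∉ with visit s x∈ z∉ (adj-sym G xz)
  ...   | t , eq with reach t (subst (z ∈_) (sym eq) (here refl)) path
  ...     | u , t⊆u , y∈ = u , (λ w∈ → t⊆u (subst (_ ∈_) (sym eq) (there w∈))) , y∈

  -- The root stays visited, so a path from it to the next target starts inside the exploration.
  exploreAll : {G : Graph n} (conn : Connected G) (targets : List (Fin n)) →
    ∃ λ (t : Exploration G) → proj₁ conn ∈ visited t × (∀ {x} → x ∈ targets → x ∈ visited t)
  exploreAll {G = G} (root , _) [] = start G root , here refl , λ ()
  exploreAll conn@(root , path) (y ∷ ys) =
    let s , root∈s , ys⊆s = exploreAll conn ys
        t , s⊆t , y∈t     = reach s root∈s (path root y)
    in t , s⊆t root∈s , λ { (here refl) → y∈t ; (there x∈) → s⊆t (ys⊆s x∈) }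

  -- Once all vertices are visited, `balance` bounds the number of kept ones from below, and
  -- `forest-bound` applies to these. The result is sr + 2α ≥ 2n - 2d with d = m - n + 1, cleared of
  -- subtraction.
  sr+2α-bound : {G : Graph n} (σ : Orientation G) → Connected G →
                4 * n ≤ sr σ + 2 * α G + 2 * edgeCount G + 2
  sr+2α-bound {n} {G} σ conn with exploreAll conn (allFin n)
  ... | t , _ , all∈ = begin
    4 * n                                                  ≡⟨ cong (4 *_) (length-tabulate {n = n} id) ⟨
    4 * length (allFin n)                                  ≡⟨ cong (4 *_) (↭-length vs↭) ⟨
    4 * length (visited t)                                 ≤⟨ balance t ⟩
    2 * length (kept t) + adjacentPairs G (visited t) + 2
      ≡⟨ cong (λ e → 2 * length (kept t) + e + 2) (trans (adjacentPairs-↭ G vs↭) (sym (2*edgeCount G))) ⟩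
    2 * length (kept t) + 2 * edgeCount G + 2
      ≤⟨ +-monoˡ-≤ 2 (+-monoˡ-≤ (2 * edgeCount G) (forest-bound σ (forest t))) ⟩
    sr σ + 2 * α G + 2 * edgeCount G + 2 ∎
    where
    open ≤-Reasoning
    vs↭ = unique-complete⇒↭allFin (visited! t) (λ x → all∈ (∈-allFin x))

open Forests

-- The second bound: counting pairs around an independent set.

module Independence where

  open import Data.Nat.Base using (_+_; _*_; _≤_; z≤n; s≤s)
  open import Data.Nat.Properties
  open Graph

  private variable
    n : ℕ

  -- Returning the rest `T` with its size allows repeated picking, which yields distinct elements.
  pick : ∀ {k} (S : Subset n) → suc k ≤ ∣ S ∣ₛ →
         ∃ λ x → x ∈ₛ S × ∃ λ T → (∀ {y} → y ∈ₛ T → y ∈ₛ S × y ≢ x) × k ≤ ∣ T ∣ₛ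
  pick (inside ∷ S) (s≤s k≤) = zero , here , outside ∷ S , (λ { (there y∈) → there y∈ , λ () }) , k≤
  pick (outside ∷ S) k< with pick S k<
  ... | x , x∈ , T , T⊆ , k≤ = suc x , there x∈ , outside ∷ T
      , (λ { (there y∈) → there (proj₁ (T⊆ y∈)) , proj₂ (T⊆ y∈) ∘ Fin.suc-injective }) , k≤

  pick₂ : (S : Subset n) → 2 ≤ ∣ S ∣ₛ → ∃ λ x → ∃ λ y → x ∈ₛ S × y ∈ₛ S × y ≢ x
  pick₂ S 2≤ with pick S 2≤
  ... | x , x∈ , T , T⊆ , 1≤ with pick T 1≤
  ...   | y , y∈ , _ = x , y , x∈ , T⊆ y∈ .proj₁ , T⊆ y∈ .proj₂

  pick₃ : (S : Subset n) → 3 ≤ ∣ S ∣ₛ →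
    ∃ λ x → ∃ λ y → ∃ λ z → (x ∈ₛ S × y ∈ₛ S × z ∈ₛ S) × (y ≢ x × z ≢ x × z ≢ y)
  pick₃ S 3≤ with pick S 3≤
  ... | x , x∈ , T , T⊆ , 2≤ with pick₂ T 2≤
  ...   | y , z , y∈ , z∈ , z≢y = x , y , z , (x∈ , T⊆ y∈ .proj₁ , T⊆ z∈ .proj₁)
                                , (T⊆ y∈ .proj₂ , T⊆ z∈ .proj₂ , z≢y)

  distinct⇒2≤∣∣ : ∀ {x y} (S : Subset n) → x ∈ₛ S → y ∈ₛ S → x ≢ y → 2 ≤ ∣ S ∣ₛ
  distinct⇒2≤∣∣ {x = x} {y} S x∈ y∈ x≢y = begin
    1 + 1               ≡⟨ cong₂ _+_ (⟦⟧-yes (x ∈ₛ? S) x∈) (⟦⟧-yes (y ∈ₛ? S) y∈) ⟨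
    χ S x + χ S y       ≤⟨ ∑-members (χ S) (∈-allFin x) (∈-allFin y) x≢y ⟩
    ∑ (allFin _) (χ S)  ≡⟨ ∑-χ S ⟩
    ∣ S ∣ₛ              ∎
    where open ≤-Reasoning

  module _ (G : Graph n) where

    maximumIndependent : ∃ λ S → Independent G S × ∣ S ∣ₛ ≡ α G
    maximumIndependent = maxCard-attained (independent? G) λ x y x∈ _ → ⊥-elim (∉⊥ x∈)

    α≤n : α G ≤ n
    α≤n = maxCard≤ (independent? G) (λ S _ → ∣p∣≤n S)

    1≤α : Fin n → 1 ≤ α G
    1≤α x = subst (_≤ α G) (∣⁅x⁆∣≡1 x) (card≤maxCard (independent? G) ⁅ x ⁆
      λ y z y∈ z∈ → adj-irrefl G (trans (x∈⁅y⁆⇒x≡y x y∈) (sym (x∈⁅y⁆⇒x≡y x z∈))))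

    -- Off the diagonal, adj + χχ ≤ 1 says that an independent set contains no
    -- edge; the δ terms make it an equality on the diagonal.
    module _ (S : Subset n) (ind : Independent G S) where

      private
        V = allFin n
        l r : Fin n → Fin n → ℕ
        l x y = adj G x y + χ S x * χ S y + δ x y
        r x y = 1 + χ S x * δ x y

      ∑l : ∑ V (λ x → ∑ V (l x)) ≡ 2 * edgeCount G + ∣ S ∣ₛ * ∣ S ∣ₛ + n
      ∑l = begin
        ∑ V (λ x → ∑ V (l x))
          ≡⟨ ∑-cong V (λ x → trans (∑-+ V _ (δ x)) (cong₂ _+_
               (trans (∑-+ V (adj G x) _) (cong (∑ V (adj G x) +_) (∑-*ˡ V (χ S x) (χ S)))) (∑-δ x))) ⟩
        ∑ V (λ x → ∑ V (adj G x) + χ S x * ∑ V (χ S) + 1)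
          ≡⟨ trans (∑-+ V _ _) (cong₂ _+_ (trans (∑-+ V _ _) (cong₂ _+_ (sym (2*edgeCount G)) (∑-*ʳ V (χ S) _))) ∑-allFin-1) ⟩
        2 * edgeCount G + ∑ V (χ S) * ∑ V (χ S) + n
          ≡⟨ cong (λ s → 2 * edgeCount G + s * s + n) (∑-χ S) ⟩
        2 * edgeCount G + ∣ S ∣ₛ * ∣ S ∣ₛ + n ∎
        where open ≡-Reasoning

      ∑r : ∑ V (λ x → ∑ V (r x)) ≡ n * n + ∣ S ∣ₛ
      ∑r = begin
        ∑ V (λ x → ∑ V (r x))
          ≡⟨ ∑-cong V (λ x → trans (∑-+ V _ _) (cong₂ _+_ (trans ∑-allFin-1 (sym (*-identityʳ n)))
               (trans (∑-*ˡ V (χ S x) (δ x)) (trans (cong (χ S x *_) (∑-δ x)) (*-identityʳ _))))) ⟩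
        ∑ V (λ x → n * 1 + χ S x)
          ≡⟨ trans (∑-+ V _ _) (cong₂ _+_ (trans (∑-*ˡ V n _) (cong (n *_) ∑-allFin-1)) (∑-χ S)) ⟩
        n * n + ∣ S ∣ₛ ∎
        where open ≡-Reasoning

      l≤r : ∀ x y → l x y ≤ r x y
      l≤r x y with x Fin.≟ y | x ∈ₛ? S | y ∈ₛ? S | adj? G x y
      ... | yes refl | _      | _      | yes xx = ⊥-elim (adj-irrefl G refl xx)
      ... | yes refl | yes x∈ | no x∉  | no _   = contradiction x∈ x∉
      ... | yes refl | yes _  | yes _  | no _   = ≤-refl
      ... | yes refl | no _   | _      | no _   = ≤-refl
      ... | no _     | yes x∈ | yes y∈ | yes xy = ⊥-elim (ind x y x∈ y∈ xy)
      ... | no _     | yes _  | yes _  | no _   = ≤-refl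
      ... | no _     | yes _  | no _   | yes _  = ≤-refl
      ... | no _     | yes _  | no _   | no _   = z≤n
      ... | no _     | no _   | _      | yes _  = ≤-refl
      ... | no _     | no _   | _      | no _   = z≤n

      -- `l≤r` summed over all ordered pairs; with a = |S| it is the familiar 2m ≤ n(n-1) - a(a-1).
      independent-bound : 2 * edgeCount G + ∣ S ∣ₛ * ∣ S ∣ₛ + n ≤ n * n + ∣ S ∣ₛ
      independent-bound = subst₂ _≤_ ∑l ∑r (∑-mono V (λ x → ∑-mono V (l≤r x)))

      -- `∑-tight`, applied to the outer sum and then to row `x`, gives equality at every pair. Off
      -- the diagonal this says adj + χχ = 1, so a pair not contained in `S` is an edge.
      independent-tight : 2 * edgeCount G + ∣ S ∣ₛ * ∣ S ∣ₛ + n ≡ n * n + ∣ S ∣ₛ →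
                          ∀ {x y} → x ≢ y → Adj G x y ⊎ (x ∈ₛ S × y ∈ₛ S)
      independent-tight eq {x} {y} x≢y with ∑-tight V (l≤r x) (≤-reflexive (sym rows)) (∈-allFin y)
        where
        rows : ∑ V (l x) ≡ ∑ V (r x)
        rows = ∑-tight V (λ x → ∑-mono V (l≤r x))
                 (≤-reflexive (trans ∑r (trans (sym eq) (sym ∑l)))) (∈-allFin x)
      -- In the cases left out, `pointwise` would equate 0 and 1.
      ... | pointwise with x Fin.≟ y | x ∈ₛ? S | y ∈ₛ? S | adj? G x y
      ...   | yes x≡y | _      | _      | _      = contradiction x≡y x≢y
      ...   | no _    | _      | _      | yes xy = inj₁ xy
      ...   | no _    | yes x∈ | yes y∈ | no _   = inj₂ (x∈ , y∈)

    -- The equality case of `α-bound`. The inequality of the theorem is an equality exactly when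
    -- this and `TightRank` both hold.
    TightAlpha : Set
    TightAlpha = 2 * edgeCount G + α G * α G + n ≡ n * n + α G

    α-bound : 2 * edgeCount G + α G * α G + n ≤ n * n + α G
    α-bound = let S , ind , ∣S∣ = maximumIndependent in
      subst (λ a → 2 * edgeCount G + a * a + n ≤ n * n + a) ∣S∣ (independent-bound S ind)

  TightRank : {G : Graph n} → Orientation G → Set
  TightRank {n} {G} σ = 4 * n ≡ sr σ + 2 * α G + 2 * edgeCount G + 2

open Independence

-- Graphs attaining both bounds.

module Extremal where

  open import Data.Nat.Base using (_+_; _*_; _≤_; z≤n; s≤s; _∸_)
  open import Data.Nat.Properties
  open import Data.Nat.Tactic.RingSolver using (solve-∀)
  open Graph

  private variable
    n : ℕ

  Complete : Graph n → Set
  Complete G = ∀ {x y} → x ≢ y → Adj G x y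

  -- Adjacency in a star with centre `z`. In contrast to `StarAdj`, whose centre is `zero`, it is
  -- carried along by every bijection of the vertices.
  JustOneIs : Fin n → Fin n → Fin n → Set
  JustOneIs z x y = x ≡ z × y ≢ z ⊎ x ≢ z × y ≡ z

  StarAt : Graph n → Fin n → Set
  StarAt G z = ∀ x y → Adj G x y ⇔ JustOneIs z x y

  StarAdj⇔ : (x y : Fin (suc n)) → StarAdj x y ⇔ JustOneIs zero x y
  StarAdj⇔ x y = mk⇔ to (from x y)
    where
    to : ∀ {x y} → StarAdj x y → JustOneIs zero x y
    to (out i) = inj₁ (refl , λ ())
    to (inn i) = inj₂ ((λ ()) , refl)
    from : ∀ x y → JustOneIs zero x y → StarAdj x y
    from zero    zero    (inj₁ (_ , y≢)) = contradiction refl y≢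
    from zero    zero    (inj₂ (x≢ , _)) = contradiction refl x≢
    from zero    (suc j) _               = out j
    from (suc i) zero    _               = inn i
    from (suc i) (suc j) (inj₁ (() , _))
    from (suc i) (suc j) (inj₂ (_ , ()))

  justOneIs-↔ : (π : Fin n ↔ Fin n) → let open Inverse π in
    ∀ {z z′} → to z ≡ z′ → ∀ x y → JustOneIs z x y ⇔ JustOneIs z′ (to x) (to y)
  justOneIs-↔ π {z} {z′} πz x y = mk⇔
    (λ { (inj₁ (p , q)) → inj₁ (≡z′ p , q ∘ ≡z) ; (inj₂ (p , q)) → inj₂ (p ∘ ≡z , ≡z′ q) })
    (λ { (inj₁ (p , q)) → inj₁ (≡z p , q ∘ ≡z′) ; (inj₂ (p , q)) → inj₂ (p ∘ ≡z′ , ≡z q) })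
    where
    open Inverse π
    ≡z : ∀ {x} → to x ≡ z′ → x ≡ z
    ≡z eq = Injection.injective (Inverse⇒Injection π) (trans eq (sym πz))
    ≡z′ : ∀ {x} → x ≡ z → to x ≡ z′
    ≡z′ refl = πz

  -- Only the position of the centre matters, so swapping `z` with `zero` is an isomorphism.
  starAt⇒≅ : (G : Graph (suc n)) → ∃ (StarAt G) → G ≅ star (suc n)
  starAt⇒≅ G (z , starAt) = π , λ x y →
    ⇔-trans (starAt x y) (⇔-trans (justOneIs-↔ π πz x y) (⇔-sym (StarAdj⇔ _ _)))
    where
    π = transpose z zero
    πz : Inverse.to π z ≡ zero
    πz rewrite dec-true (z Fin.≟ z) refl = refl

  ≅⇒starAt : (G : Graph (suc n)) → G ≅ star (suc n) → ∃ (StarAt G)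
  ≅⇒starAt G (π , iso) = from zero , λ x y →
    ⇔-trans (iso x y) (⇔-trans (StarAdj⇔ _ _) (⇔-sym (justOneIs-↔ π (inverseˡ refl) x y)))
    where open Inverse π

  another : (z : Fin (suc (suc n))) → ∃ λ y → y ≢ z
  another zero    = suc zero , λ ()
  another (suc z) = zero , λ ()

  -- A path between two distinct vertices has a first edge.
  connected⇒edge : {G : Graph n} → Connected G → 2 ≤ n → ∃ λ x → ∃ λ y → Adj G x y
  connected⇒edge {suc (suc n)} {G} (_ , path) _ = firstEdge (λ ()) (path zero (suc zero))
    where
    firstEdge : ∀ {x y} → x ≢ y → Star (Adj G) x y → ∃ λ x → ∃ λ y → Adj G x y
    firstEdge x≢x ε        = contradiction refl x≢x
    firstEdge _   (xz ◅ _) = _ , _ , xz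
  connected⇒edge {suc zero} _ (s≤s ())

  edge⇒1≤sr : {G : Graph n} (σ : Orientation G) → ∀ {x y} → Adj G x y → 1 ≤ sr σ
  edge⇒1≤sr σ {x} {y} xy = rowsIndependent⇒≤sr σ {x ∷ []} {y ∷ []} ([] ∷ []) (singleRow σ xy)

  single-vertex⇒≅ : ∀ n (G : Graph (suc n)) → ¬ 2 ≤ suc n → G ≅ star (suc n)
  single-vertex⇒≅ (suc n) G n<2 = ⊥-elim (n<2 (s≤s (s≤s z≤n)))
  single-vertex⇒≅ zero    G _   = starAt⇒≅ G (zero , λ { zero zero → mk⇔ (⊥-elim ∘ adj-irrefl G refl)
    λ { (inj₁ (_ , z≢z)) → contradiction refl z≢z ; (inj₂ (z≢z , _)) → contradiction refl z≢z } })

  complete⇒≅C₃ : (G : Graph n) → n ≡ 3 → Complete G → G ≅ C₃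
  complete⇒≅C₃ G refl complete = ↔-id _ , λ x y → mk⇔ (λ xy x≡y → adj-irrefl G x≡y xy) complete

  -- With k = n - α and s = sr, combining the two equalities eliminates m.
  classify : ∀ k a s → 1 ≤ a → s + 2 + k * k + 2 * k * a ≡ 5 * k + 2 * a →
             k ≡ 0 ⊎ k ≡ 1 ⊎ (k ≡ 2 × a ≡ 1) ⊎ (2 ≤ k × s ≡ 0)
  classify 0 a s _ _ = inj₁ refl
  classify 1 a s _ _ = inj₂ (inj₁ refl)
  classify 2 1 s _ _ = inj₂ (inj₂ (inj₁ (refl , refl)))
  -- The left side exceeds the right by `s + 2 * a` here, by `s + 4 * a` for k = 3, and by a
  -- positive number for k ≥ 4.
  classify 2 (suc (suc a)) s _ eq = inj₂ (inj₂ (inj₂ (s≤s (s≤s z≤n) , s≡0)))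
    where
    lemma : ∀ s a → s + 2 + 2 * 2 + 2 * 2 * (2 + a) ≡ (s + 2 * a) + (5 * 2 + 2 * (2 + a))
    lemma = solve-∀
    s≡0 : s ≡ 0
    s≡0 = m+n≡0⇒m≡0 s (+-cancelʳ-≡ _ (s + 2 * a) 0 (trans (sym (lemma s a)) eq))
  classify 3 (suc a) s _ eq = inj₂ (inj₂ (inj₂ (s≤s (s≤s z≤n) , s≡0)))
    where
    lemma : ∀ s a → s + 2 + 3 * 3 + 2 * 3 * (1 + a) ≡ (s + 4 * a) + (5 * 3 + 2 * (1 + a))
    lemma = solve-∀
    s≡0 : s ≡ 0
    s≡0 = m+n≡0⇒m≡0 s (+-cancelʳ-≡ _ (s + 4 * a) 0 (trans (sym (lemma s a)) eq))
  classify (suc (suc (suc (suc j)))) (suc a) s _ eq = contradiction (trans (sym eq) (lemma s j a)) (m≢1+m+n _)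
    where
    lemma : ∀ s j a → s + 2 + (4 + j) * (4 + j) + 2 * (4 + j) * (1 + a)
                    ≡ suc (5 * (4 + j) + 2 * (1 + a) + (s + 3 + 5 * j + j * j + 2 * (3 + j) * a))
    lemma = solve-∀

  -- Adding the two equalities for n = k + a makes 2m cancel; the padding `3 * a + a * a` avoids
  -- subtraction.
  complement-equation : ∀ k a s m → 2 * m + a * a + (k + a) ≡ (k + a) * (k + a) + a →
    4 * (k + a) ≡ s + 2 * a + 2 * m + 2 → s + 2 + k * k + 2 * k * a ≡ 5 * k + 2 * a
  complement-equation k a s m eqα eqr = +-cancelʳ-≡ (3 * a + a * a) _ _ (begin
    s + 2 + k * k + 2 * k * a + (3 * a + a * a)           ≡⟨ l₁ k a s ⟩
    ((k + a) * (k + a) + a) + (s + 2 * a + 2)             ≡⟨ cong (_+ (s + 2 * a + 2)) eqα ⟨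
    (2 * m + a * a + (k + a)) + (s + 2 * a + 2)           ≡⟨ l₂ k a s m ⟩
    (s + 2 * a + 2 * m + 2) + (a * a + (k + a))           ≡⟨ cong (_+ (a * a + (k + a))) eqr ⟨
    4 * (k + a) + (a * a + (k + a))                       ≡⟨ l₃ k a ⟩
    5 * k + 2 * a + (3 * a + a * a)                       ∎)
    where
    open ≡-Reasoning
    l₁ : ∀ k a s → s + 2 + k * k + 2 * k * a + (3 * a + a * a) ≡ ((k + a) * (k + a) + a) + (s + 2 * a + 2)
    l₁ = solve-∀
    l₂ : ∀ k a s m → (2 * m + a * a + (k + a)) + (s + 2 * a + 2) ≡ (s + 2 * a + 2 * m + 2) + (a * a + (k + a))
    l₂ = solve-∀
    l₃ : ∀ k a → 4 * (k + a) + (a * a + (k + a)) ≡ 5 * k + 2 * a + (3 * a + a * a)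
    l₃ = solve-∀

  -- `k` counts the vertices outside a maximum independent set `S`, and by `join` each of them is
  -- adjacent to all other vertices. So k = 0 leaves a single vertex, k = 1 a star, and k = 2 with α
  -- = 1 a complete graph on three vertices; the remaining case has an edge but skew-rank 0.
  tight⇒≅ : {G : Graph n} (σ : Orientation G) → Connected G → TightAlpha G → TightRank σ →
            G ≅ star n ⊎ G ≅ C₃
  tight⇒≅ {zero} σ (() , _)
  tight⇒≅ {n@(suc n′)} {G} σ conn tα tr with maximumIndependent G
  ... | S , ind , ∣S∣ = conclude (classify k (α G) (sr σ) (1≤α G zero)
          (complement-equation k (α G) (sr σ) (edgeCount G)
             (subst (λ v → 2 * edgeCount G + α G * α G + v ≡ v * v + α G) (sym k+α) tα)
             (subst (λ v → 4 * v ≡ sr σ + 2 * α G + 2 * edgeCount G + 2) (sym k+α) tr)))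
    where
    k = n ∸ α G
    k+α : k + α G ≡ n
    k+α = m∸n+n≡m (α≤n G)

    ∣∁S∣ : ∣ ∁ S ∣ₛ ≡ k
    ∣∁S∣ = trans (∣∁p∣≡n∸∣p∣ S) (cong (n ∸_) ∣S∣)

    join : ∀ {x y} → x ≢ y → Adj G x y ⊎ (x ∈ₛ S × y ∈ₛ S)
    join = independent-tight G S ind (subst (λ a → 2 * edgeCount G + a * a + n ≡ n * n + a) (sym ∣S∣) tα)

    no-edge : sr σ ≡ 0 → ¬ 2 ≤ n
    no-edge sr≡0 2≤n = let _ , _ , xy = connected⇒edge {G = G} conn 2≤n in
      contradiction (subst (1 ≤_) sr≡0 (edge⇒1≤sr σ xy)) λ ()

    all-independent : k ≡ 0 → ¬ 2 ≤ n
    all-independent k≡0 2≤n = let x , y , xy = connected⇒edge {G = G} conn 2≤n in ind x y all all xy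
      where
      S≡⊤ : S ≡ ⊤
      S≡⊤ = ∣p∣≡n⇒p≡⊤ (trans ∣S∣ (trans (sym (cong (_+ α G) k≡0)) k+α))
      all : ∀ {x} → x ∈ₛ S
      all = subst (_ ∈ₛ_) (sym S≡⊤) ∈⊤

    starAt : k ≡ 1 → ∃ (StarAt G)
    starAt k≡1 with pick (∁ S) (≤-reflexive (sym (trans ∣∁S∣ k≡1)))
    ... | z , z∈∁S , _ = z , λ x y → mk⇔ (to x y) (from x y)
      where
      z∉S : z ∉ₛ S
      z∉S = x∈∁p⇒x∉p z∈∁S
      ≢z⇒∈S : ∀ {x} → x ≢ z → x ∈ₛ S
      ≢z⇒∈S {x} x≢z with x ∈ₛ? S
      ... | yes x∈ = x∈
      ... | no x∉  = contradiction (distinct⇒2≤∣∣ (∁ S) (x∉p⇒x∈∁p x∉) z∈∁S x≢z)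
                                   (<⇒≱ (s≤s (≤-reflexive (trans ∣∁S∣ k≡1))))
      to : ∀ x y → Adj G x y → JustOneIs z x y
      to x y xy with x Fin.≟ z | y Fin.≟ z
      ... | yes refl | yes refl = ⊥-elim (adj-irrefl G refl xy)
      ... | yes x≡z  | no y≢z   = inj₁ (x≡z , y≢z)
      ... | no x≢z   | yes y≡z  = inj₂ (x≢z , y≡z)
      ... | no x≢z   | no y≢z   = ⊥-elim (ind x y (≢z⇒∈S x≢z) (≢z⇒∈S y≢z) xy)
      from : ∀ x y → JustOneIs z x y → Adj G x y
      from x y (inj₁ (refl , y≢z)) with join (y≢z ∘ sym)
      ... | inj₁ xy       = xy
      ... | inj₂ (z∈ , _) = contradiction z∈ z∉S
      from x y (inj₂ (x≢z , refl)) with join x≢z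
      ... | inj₁ xy       = xy
      ... | inj₂ (_ , z∈) = contradiction z∈ z∉S

    complete : α G ≡ 1 → Complete G
    complete α≡1 x≢y with join x≢y
    ... | inj₁ xy        = xy
    ... | inj₂ (x∈ , y∈) = contradiction (distinct⇒2≤∣∣ S x∈ y∈ x≢y) (<⇒≱ (s≤s (≤-reflexive (trans ∣S∣ α≡1))))

    conclude : k ≡ 0 ⊎ k ≡ 1 ⊎ (k ≡ 2 × α G ≡ 1) ⊎ (2 ≤ k × sr σ ≡ 0) → G ≅ star n ⊎ G ≅ C₃
    conclude (inj₁ k≡0) = inj₁ (single-vertex⇒≅ n′ G (all-independent k≡0))
    conclude (inj₂ (inj₁ k≡1)) = inj₁ (starAt⇒≅ G (starAt k≡1))
    conclude (inj₂ (inj₂ (inj₁ (k≡2 , α≡1)))) =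
      inj₂ (complete⇒≅C₃ G (trans (sym k+α) (cong₂ _+_ k≡2 α≡1)) (complete α≡1))
    conclude (inj₂ (inj₂ (inj₂ (2≤k , sr≡0)))) = ⊥-elim (no-edge sr≡0 (≤-trans 2≤k (m∸n≤m n (α G))))

open Extremal

-- Upper bounds on the skew-rank of stars and triangles.

module RankBounds where

  open import Data.Nat.Base using (_≤_; z≤n)
  open import Data.Nat.Properties using (≤-antisym; ≮⇒≥)
  open import Data.Rational.Base using (ℚ; 0ℚ; 1ℚ; _+_; _*_; -_)
  open import Data.Rational.Properties using (*-zeroˡ; +-*-commutativeRing)
  open import Algebra.Properties.Semiring.Sum (CommutativeRing.semiring +-*-commutativeRing) using (sum)
  open import Data.Rational.Solver
  open +-*-Solver using (solve; _:=_; _:+_; _:*_; :-_; con)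
  open Graph

  private variable
    n : ℕ

  -- The rows of two leaves vanish outside column `z`, so they are proportional; `c` is the
  -- combination that cancels them.
  star⇒no-two-leaf-rows : {G : Graph n} (σ : Orientation G) → ∀ {z} → StarAt G z →
    ∀ {R} → IndependentRows (skewAdjacency σ) R →
    ∀ {x y} → x ∈ₛ R → y ∈ₛ R → x ≢ z → y ≢ z → ¬ (x ≢ y)
  star⇒no-two-leaf-rows {n = n} {G} σ {z} starAt {R} ind {x} {y} x∈ y∈ x≢z y≢z x≢y =
    skew-adj σ (leaf y≢z) (trans (sym cx) (ind c c∉ c0 x))
    where
    S = skewAdjacency σ
    leaf : ∀ {x} → x ≢ z → Adj G x z
    leaf {x} x≢z = Equivalence.from (starAt x z) (inj₂ (x≢z , refl))
    leaf-col : ∀ {x j} → x ≢ z → j ≢ z → S x j ≡ 0ℚ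
    leaf-col {x} {j} x≢z j≢z = skew-nonadj σ λ xj → case (Equivalence.to (starAt x j) xj)
      where
      case : ¬ JustOneIs z x j
      case (inj₁ (x≡z , _)) = x≢z x≡z
      case (inj₂ (_ , j≡z)) = j≢z j≡z
    c : Fin n → ℚ
    c i with i Fin.≟ x | i Fin.≟ y
    ... | yes _ | _     = S y z
    ... | no _  | yes _ = - S x z
    ... | no _  | no _  = 0ℚ
    cx : c x ≡ S y z
    cx with x Fin.≟ x
    ... | yes _  = refl
    ... | no x≢x = contradiction refl x≢x
    cy : c y ≡ - S x z
    cy with y Fin.≟ x | y Fin.≟ y
    ... | yes y≡x | _      = contradiction (sym y≡x) x≢y
    ... | no _    | yes _  = refl
    ... | no _    | no y≢y = contradiction refl y≢y
    c≢ : ∀ i → i ≢ x → i ≢ y → c i ≡ 0ℚ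
    c≢ i i≢x i≢y with i Fin.≟ x | i Fin.≟ y
    ... | yes i≡x | _       = contradiction i≡x i≢x
    ... | no _    | yes i≡y = contradiction i≡y i≢y
    ... | no _    | no _    = refl
    c∉ : ∀ i → i ∉ₛ R → c i ≡ 0ℚ
    c∉ i i∉ = c≢ i (λ { refl → i∉ x∈ }) (λ { refl → i∉ y∈ })
    c0 : ∀ j → sum (λ i → c i * S i j) ≡ 0ℚ
    c0 j = trans (sum-pair _ x≢y λ i i≢x i≢y → trans (cong (_* S i j) (c≢ i i≢x i≢y)) (*-zeroˡ (S i j)))
                 (trans (cong₂ (λ a b → a * S x j + b * S y j) cx cy) cancel)
      where
      cancel : S y z * S x j + - S x z * S y j ≡ 0ℚ
      cancel with j Fin.≟ z
      ... | yes refl = solve 2 (λ a b → a :* b :+ (:- b) :* a := con 0ℚ) refl (S y z) (S x z)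
      ... | no j≢z   = trans (cong₂ (λ a b → S y z * a + - S x z * b) (leaf-col x≢z j≢z) (leaf-col y≢z j≢z))
                             (solve 2 (λ a b → a :* con 0ℚ :+ (:- b) :* con 0ℚ := con 0ℚ) refl (S y z) (S x z))

  -- Of three distinct rows at most one belongs to the centre, so two belong to leaves.
  star⇒sr≤2 : {G : Graph n} (σ : Orientation G) → ∃ (StarAt G) → sr σ ≤ 2
  star⇒sr≤2 σ (z , starAt) = maxCard≤ (independentRows? (skewAdjacency σ)) λ R ind →
    ≮⇒≥ λ 3≤ → three R ind (pick₃ R 3≤)
    where
    three : ∀ R → IndependentRows (skewAdjacency σ) R →
            ¬ (∃ λ x → ∃ λ y → ∃ λ w → (x ∈ₛ R × y ∈ₛ R × w ∈ₛ R) × (y ≢ x × w ≢ x × w ≢ y))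
    three R ind (x , y , w , (x∈ , y∈ , w∈) , (y≢x , w≢x , w≢y)) with x Fin.≟ z | y Fin.≟ z
    ... | yes refl | _        = star⇒no-two-leaf-rows σ starAt ind w∈ y∈ w≢x y≢x w≢y
    ... | no x≢z   | yes refl = star⇒no-two-leaf-rows σ starAt ind w∈ x∈ w≢y x≢z w≢x
    ... | no x≢z   | no y≢z   = star⇒no-two-leaf-rows σ starAt ind y∈ x∈ y≢z x≢z y≢x

  one-vertex⇒sr≤0 : {G : Graph 1} (σ : Orientation G) → sr σ ≤ 0
  one-vertex⇒sr≤0 {G} σ = maxCard≤ (independentRows? (skewAdjacency σ)) bound
    where
    bound : ∀ R → IndependentRows (skewAdjacency σ) R → ∣ R ∣ₛ ≤ 0
    bound (outside ∷ []) _   = z≤n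
    bound (inside ∷ [])  ind = contradiction
      (ind (λ _ → 1ℚ) (λ { zero ∉ → contradiction here ∉ })
        (λ { zero → cong (λ a → 1ℚ * a + 0ℚ) (skew-nonadj σ (adj-irrefl G refl)) }) zero)
      λ ()

  -- A skew-symmetric 3 × 3 matrix with upper entries a, b, c has (c, -b, a) in its kernel.
  triangle⇒sr≤2 : {G : Graph 3} (σ : Orientation G) → Complete G → sr σ ≤ 2
  triangle⇒sr≤2 {G} σ complete = maxCard≤ (independentRows? S) λ R ind → ≮⇒≥ λ 3≤ →
    -- Three independent rows are all rows, so `kernel` would have to vanish; but its first entry
    -- `c` belongs to an edge and is nonzero.
    skew-adj σ (complete {suc zero} {suc (suc zero)} λ ())
      (ind kernel (λ i i∉ → contradiction (subst (i ∈ₛ_) (sym (∣p∣≡n⇒p≡⊤ (≤-antisym (∣p∣≤n R) 3≤))) ∈⊤) i∉) kernel0 zero)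
    where
    S = skewAdjacency σ
    a = S zero (suc zero)
    b = S zero (suc (suc zero))
    c = S (suc zero) (suc (suc zero))
    kernel : Fin 3 → ℚ
    kernel zero             = c
    kernel (suc zero)       = - b
    kernel (suc (suc zero)) = a
    diag : ∀ x → S x x ≡ 0ℚ
    diag x = skew-nonadj σ (adj-irrefl G refl)
    column : ∀ j → c * S zero j + (- b * S (suc zero) j + (a * S (suc (suc zero)) j + 0ℚ)) ≡ 0ℚ
    column zero
      rewrite diag zero | skew-antisym σ zero (suc zero) | skew-antisym σ zero (suc (suc zero)) =
      solve 3 (λ a b c → c :* con 0ℚ :+ ((:- b) :* (:- a) :+ (a :* (:- b) :+ con 0ℚ)) := con 0ℚ) refl a b c
    column (suc zero)
      rewrite diag (suc zero) | skew-antisym σ (suc zero) (suc (suc zero)) =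
      solve 3 (λ a b c → c :* a :+ ((:- b) :* con 0ℚ :+ (a :* (:- c) :+ con 0ℚ)) := con 0ℚ) refl a b c
    column (suc (suc zero))
      rewrite diag (suc (suc zero)) =
      solve 3 (λ a b c → c :* b :+ ((:- b) :* c :+ (a :* con 0ℚ :+ con 0ℚ)) := con 0ℚ) refl a b c
    kernel0 : ∀ j → sum (λ i → kernel i * S i j) ≡ 0ℚ
    kernel0 j = column j

open RankBounds

-- Stars and triangles attain both bounds.

module Tightness where

  open import Data.Nat.Base using (_+_; _*_; _≤_; s≤s⁻¹; _∸_)
  open import Data.Nat.Properties
  open import Data.Nat.Tactic.RingSolver using (solve-∀)
  open Graph

  private variable
    n : ℕ

  -- Sums adj x y + 2 δ x z δ y z = δ x z + δ y z over all ordered pairs; both sides count how many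
  -- of x, y are the centre.
  star-2*edgeCount : (G : Graph n) → ∃ (StarAt G) → 2 * edgeCount G + 2 ≡ 2 * n
  star-2*edgeCount {n} G (z , starAt) = begin
    2 * edgeCount G + 2
      ≡⟨ cong₂ _+_ (2*edgeCount G) (sym (cong₂ _+_ (∑-δʳ z) (∑-δʳ z))) ⟩
    adjacentPairs G V + (∑ V δz + ∑ V δz)
      ≡⟨ trans (∑-+ V _ _) (cong (adjacentPairs G V +_) (∑-+ V δz δz)) ⟨
    ∑ V (λ x → ∑ V (adj G x) + (δz x + δz x))
      ≡⟨ ∑-cong V (λ x → trans (∑-+ V _ _) (cong (∑ V (adj G x) +_)
           (trans (∑-*ˡ V (δz x + δz x) δz) (trans (cong ((δz x + δz x) *_) (∑-δʳ z)) (*-identityʳ _))))) ⟨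
    ∑ V (λ x → ∑ V (λ y → adj G x y + (δz x + δz x) * δz y))
      ≡⟨ ∑-cong V (λ x → ∑-cong V (pointwise x)) ⟩
    ∑ V (λ x → ∑ V (λ y → δz x * 1 + δz y))
      ≡⟨ ∑-cong V (λ x → trans (∑-+ V _ _) (cong₂ _+_ (trans (∑-*ˡ V (δz x) _) (cong (δz x *_) ∑-allFin-1)) (∑-δʳ z))) ⟩
    ∑ V (λ x → δz x * n + 1)
      ≡⟨ trans (∑-+ V _ _) (cong₂ _+_ (trans (∑-*ʳ V δz n) (cong (_* n) (∑-δʳ z))) ∑-allFin-1) ⟩
    1 * n + n
      ≡⟨ +-comm (1 * n) n ⟩
    2 * n ∎
    where
    open ≡-Reasoning
    V = allFin n
    δz : Fin n → ℕ
    δz x = δ x z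
    pointwise : ∀ x y → adj G x y + (δz x + δz x) * δz y ≡ δz x * 1 + δz y
    pointwise x y with x Fin.≟ z | y Fin.≟ z
    ... | yes refl | yes refl = cong (_+ 2) (adj-self G x)
    ... | yes refl | no y≢z   = cong (_+ 0) (⟦⟧-yes (adj? G x y) (Equivalence.from (starAt x y) (inj₁ (refl , y≢z))))
    ... | no x≢z   | yes refl = cong (_+ 0) (⟦⟧-yes (adj? G x y) (Equivalence.from (starAt x y) (inj₂ (x≢z , refl))))
    ... | no x≢z   | no y≢z   = cong (_+ 0) (⟦⟧-no (adj? G x y) λ xy → case (Equivalence.to (starAt x y) xy))
      where
      case : ¬ JustOneIs z x y
      case (inj₁ (x≡z , _)) = x≢z x≡z
      case (inj₂ (_ , y≡z)) = y≢z y≡z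

  -- The leaves are independent, and the only larger set, that of all vertices, contains an edge. A
  -- single vertex behaves differently: there α equals the number of vertices.
  star-α : (G : Graph (suc (suc n))) → ∃ (StarAt G) → α G ≡ suc n
  star-α {n} G (z , starAt) = ≤-antisym
    (maxCard≤ (independent? G) λ S ind → s≤s⁻¹ (≤∧≢⇒< (∣p∣≤n S) (not-all S ind)))
    (subst (_≤ α G) (trans (∣∁p∣≡n∸∣p∣ ⁅ z ⁆) (cong (suc (suc n) ∸_) (∣⁅x⁆∣≡1 z)))
      (card≤maxCard (independent? G) (∁ ⁅ z ⁆) leaves))
    where
    ≢z : ∀ {x} → x ∈ₛ ∁ ⁅ z ⁆ → x ≢ z
    ≢z x∈ refl = x∈∁p⇒x∉p x∈ (x∈⁅x⁆ z)
    leaves : Independent G (∁ ⁅ z ⁆)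
    leaves x y x∈ y∈ xy with Equivalence.to (starAt x y) xy
    ... | inj₁ (x≡z , _) = ≢z x∈ x≡z
    ... | inj₂ (_ , y≡z) = ≢z y∈ y≡z
    not-all : ∀ S → Independent G S → ∣ S ∣ₛ ≢ suc (suc n)
    not-all S ind ∣S∣ = let y , y≢z = another z in
      ind z y all all (Equivalence.from (starAt z y) (inj₁ (refl , y≢z)))
      where
      all : ∀ {x} → x ∈ₛ S
      all = subst (_ ∈ₛ_) (sym (∣p∣≡n⇒p≡⊤ ∣S∣)) ∈⊤

  -- Every ordered pair is either an edge or on the diagonal, which `δ` counts.
  complete-2*edgeCount : (G : Graph n) → Complete G → 2 * edgeCount G + n ≡ n * n
  complete-2*edgeCount {n} G complete = begin
    2 * edgeCount G + n
      ≡⟨ cong₂ _+_ (2*edgeCount G) (sym (trans (∑-cong V ∑-δ) ∑-allFin-1)) ⟩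
    adjacentPairs G V + ∑ V (λ x → ∑ V (δ x))
      ≡⟨ trans (∑-cong V (λ x → ∑-+ V (adj G x) (δ x))) (∑-+ V _ _) ⟨
    ∑ V (λ x → ∑ V (λ y → adj G x y + δ x y))
      ≡⟨ ∑-cong V (λ x → trans (∑-cong V (pointwise x)) (trans ∑-allFin-1 (sym (*-identityʳ n)))) ⟩
    ∑ V (λ x → n * 1)
      ≡⟨ trans (∑-*ˡ V n _) (cong (n *_) ∑-allFin-1) ⟩
    n * n ∎
    where
    open ≡-Reasoning
    V = allFin n
    pointwise : ∀ x y → adj G x y + δ x y ≡ 1
    pointwise x y with x Fin.≟ y
    ... | yes refl = cong (_+ 1) (adj-self G x)
    ... | no x≢y   = cong (_+ 0) (⟦⟧-yes (adj? G x y) (complete x≢y))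

  complete-α : (G : Graph (suc n)) → Complete G → α G ≡ 1
  complete-α G complete = ≤-antisym
    (maxCard≤ (independent? G) λ S ind → ≮⇒≥ λ 2≤ →
      let x , y , x∈ , y∈ , y≢x = pick₂ S 2≤ in ind y x y∈ x∈ (complete y≢x))
    (1≤α G zero)

  -- One half of `TightRank` is the general bound; the other follows from sr ≤ 2 and m = α = n - 1,
  -- or for a single vertex from sr = 0, m = 0 and α = 1.
  star⇒tight : {G : Graph n} (σ : Orientation G) → Connected G → G ≅ star n → TightAlpha G × TightRank σ
  star⇒tight {zero} σ (() , _)
  star⇒tight {suc zero} {G} σ conn iso =
    subst₂ (λ a e → e + a * a + 1 ≡ 1 + a) (sym α≡1) (sym 2m≡0) refl ,
    ≤-antisym (sr+2α-bound σ conn)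
      (subst₂ (λ a e → sr σ + 2 * a + e + 2 ≤ 4) (sym α≡1) (sym 2m≡0)
        (+-monoˡ-≤ 2 (+-monoˡ-≤ 0 (+-monoˡ-≤ 2 (one-vertex⇒sr≤0 σ)))))
    where
    α≡1 : α G ≡ 1
    α≡1 = ≤-antisym (α≤n G) (1≤α G zero)
    2m≡0 : 2 * edgeCount G ≡ 0
    2m≡0 = +-cancelʳ-≡ 2 _ 0 (star-2*edgeCount G (≅⇒starAt G iso))
  star⇒tight {suc (suc n)} {G} σ conn iso =
    subst₂ (λ a e → e + a * a + (2 + n) ≡ (2 + n) * (2 + n) + a) (sym α≡) (sym 2m≡) (tα n) ,
    ≤-antisym (sr+2α-bound σ conn)
      (subst₂ (λ a e → sr σ + 2 * a + e + 2 ≤ 4 * (2 + n)) (sym α≡) (sym 2m≡) (begin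
        sr σ + 2 * suc n + 2 * suc n + 2
          ≤⟨ +-monoˡ-≤ 2 (+-monoˡ-≤ (2 * suc n) (+-monoˡ-≤ (2 * suc n) (star⇒sr≤2 σ starAt))) ⟩
        2 + 2 * suc n + 2 * suc n + 2 ≡⟨ tr n ⟩
        4 * (2 + n) ∎))
    where
    open ≤-Reasoning
    starAt = ≅⇒starAt G iso
    α≡ : α G ≡ suc n
    α≡ = star-α G starAt
    double : ∀ n → 2 * (2 + n) ≡ 2 * suc n + 2
    double = solve-∀
    2m≡ : 2 * edgeCount G ≡ 2 * suc n
    2m≡ = +-cancelʳ-≡ 2 _ _ (trans (star-2*edgeCount G starAt) (double n))
    tα : ∀ n → 2 * suc n + suc n * suc n + (2 + n) ≡ (2 + n) * (2 + n) + suc n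
    tα = solve-∀
    tr : ∀ n → 2 + 2 * suc n + 2 * suc n + 2 ≡ 4 * (2 + n)
    tr = solve-∀

  C₃⇒tight : {G : Graph n} (σ : Orientation G) → Connected G → G ≅ C₃ → TightAlpha G × TightRank σ
  C₃⇒tight {G = G} σ conn (π , iso) with refl ← ↔⇒≡ π =
    subst₂ (λ a e → e + a * a + 3 ≡ 9 + a) (sym α≡1) (sym 2m≡6) refl ,
    ≤-antisym (sr+2α-bound σ conn)
      (subst₂ (λ a e → sr σ + 2 * a + e + 2 ≤ 12) (sym α≡1) (sym 2m≡6)
        (+-monoˡ-≤ 2 (+-monoˡ-≤ 6 (+-monoˡ-≤ 2 (triangle⇒sr≤2 σ complete)))))
    where
    complete : Complete G
    complete {x} {y} x≢y = Equivalence.from (iso x y) (x≢y ∘ Injection.injective (Inverse⇒Injection π))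
    α≡1 : α G ≡ 1
    α≡1 = complete-α G complete
    2m≡6 : 2 * edgeCount G ≡ 6
    2m≡6 = +-cancelʳ-≡ 3 _ 6 (complete-2*edgeCount G complete)

-- From bounds in the natural numbers to an inequality of Dedekind reals.

module Reals where

  open import Data.Integer.Base as ℤ using (ℤ; +_)
  import Data.Integer.Properties as ℤ
  open import Data.Rational.Base
  open import Data.Rational.Properties
  open import Data.Rational.Solver
  open import Data.Rational.Unnormalised.Base as ℚᵘ using (mkℚᵘ; *≡*; *≤*; *<*)
  import Data.Rational.Unnormalised.Properties as ℚᵘ
  open +-*-Solver using (solve; _:=_; _:+_; _:*_; :-_; _:-_; con)
  open ℝ

  private
    -- `fromℤ i` is a fraction in lowest terms; the laws of `fromℤ` are checked on the unnormalised
    -- fraction i over 1, where sums and products have plain formulas.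
    toℚᵘ-fromℤ : ∀ i → toℚᵘ (fromℤ i) ℚᵘ.≃ mkℚᵘ i 0
    toℚᵘ-fromℤ i = toℚᵘ-fromℚᵘ (mkℚᵘ i 0)

  fromℤ-+ : ∀ i j → fromℤ (i ℤ.+ j) ≡ fromℤ i + fromℤ j
  fromℤ-+ i j = toℚᵘ-injective (begin
    toℚᵘ (fromℤ (i ℤ.+ j))              ≈⟨ toℚᵘ-fromℤ (i ℤ.+ j) ⟩
    mkℚᵘ (i ℤ.+ j) 0                    ≈⟨ *≡* (cong (ℤ._* + 1) (cong₂ ℤ._+_ (ℤ.*-identityʳ i) (ℤ.*-identityʳ j))) ⟨
    mkℚᵘ i 0 ℚᵘ.+ mkℚᵘ j 0              ≈⟨ ℚᵘ.+-cong (toℚᵘ-fromℤ i) (toℚᵘ-fromℤ j) ⟨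
    toℚᵘ (fromℤ i) ℚᵘ.+ toℚᵘ (fromℤ j)  ≈⟨ toℚᵘ-homo-+ (fromℤ i) (fromℤ j) ⟨
    toℚᵘ (fromℤ i + fromℤ j)            ∎)
    where open import Relation.Binary.Reasoning.Setoid ℚᵘ.≃-setoid

  fromℤ-* : ∀ i j → fromℤ (i ℤ.* j) ≡ fromℤ i * fromℤ j
  fromℤ-* i j = toℚᵘ-injective (begin
    toℚᵘ (fromℤ (i ℤ.* j))              ≈⟨ toℚᵘ-fromℤ (i ℤ.* j) ⟩
    mkℚᵘ i 0 ℚᵘ.* mkℚᵘ j 0              ≈⟨ ℚᵘ.*-cong (toℚᵘ-fromℤ i) (toℚᵘ-fromℤ j) ⟨
    toℚᵘ (fromℤ i) ℚᵘ.* toℚᵘ (fromℤ j)  ≈⟨ toℚᵘ-homo-* (fromℤ i) (fromℤ j) ⟨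
    toℚᵘ (fromℤ i * fromℤ j)            ∎)
    where open import Relation.Binary.Reasoning.Setoid ℚᵘ.≃-setoid

  fromℤ-mono-≤ : ∀ {i j} → i ℤ.≤ j → fromℤ i ≤ fromℤ j
  fromℤ-mono-≤ {i} {j} i≤j = toℚᵘ-cancel-≤ (ℚᵘ.≤-respˡ-≃ (ℚᵘ.≃-sym (toℚᵘ-fromℤ i))
    (ℚᵘ.≤-respʳ-≃ (ℚᵘ.≃-sym (toℚᵘ-fromℤ j)) (*≤* (ℤ.*-monoʳ-≤-nonNeg (+ 1) i≤j))))

  fromℤ-mono-< : ∀ {i j} → i ℤ.< j → fromℤ i < fromℤ j
  fromℤ-mono-< {i} {j} i<j = toℚᵘ-cancel-< (ℚᵘ.<-respˡ-≃ (ℚᵘ.≃-sym (toℚᵘ-fromℤ i))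
    (ℚᵘ.<-respʳ-≃ (ℚᵘ.≃-sym (toℚᵘ-fromℤ j)) (*<* (ℤ.*-monoʳ-<-pos (+ 1) i<j))))

  fromℤ-neg : ∀ i → fromℤ (ℤ.- i) ≡ - fromℤ i
  fromℤ-neg i = toℚᵘ-injective (begin
    toℚᵘ (fromℤ (ℤ.- i))   ≈⟨ toℚᵘ-fromℤ (ℤ.- i) ⟩
    ℚᵘ.- mkℚᵘ i 0          ≈⟨ ℚᵘ.-‿cong (toℚᵘ-fromℤ i) ⟨
    ℚᵘ.- toℚᵘ (fromℤ i)    ≈⟨ toℚᵘ-homo‿- (fromℤ i) ⟨
    toℚᵘ (- fromℤ i)       ∎)
    where open import Relation.Binary.Reasoning.Setoid ℚᵘ.≃-setoid

  fromℤ-- : ∀ i j → fromℤ (i ℤ.- j) ≡ fromℤ i - fromℤ j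
  fromℤ-- i j = trans (fromℤ-+ i (ℤ.- j)) (cong (λ x → fromℤ i + x) (fromℤ-neg j))

  ι : ℕ → ℚ
  ι k = fromℤ (+ k)

  ι-+ : ∀ k l → ι (k ℕ.+ l) ≡ ι k + ι l
  ι-+ k l = fromℤ-+ (+ k) (+ l)

  ι-* : ∀ k l → ι (k ℕ.* l) ≡ ι k * ι l
  ι-* k l = trans (cong fromℤ (ℤ.pos-* k l)) (fromℤ-* (+ k) (+ l))

  ι-mono-≤ : ∀ {k l} → k ℕ.≤ l → ι k ≤ ι l
  ι-mono-≤ k≤l = fromℤ-mono-≤ (ℤ.+≤+ k≤l)

  ι-mono-< : ∀ {k l} → k ℕ.< l → ι k < ι l
  ι-mono-< k<l = fromℤ-mono-< (ℤ.+<+ k<l)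

  square-mono-≤ : ∀ {p q} → 0ℚ ≤ p → p ≤ q → p * p ≤ q * q
  square-mono-≤ {p} {q} 0≤p p≤q = ≤-trans
    (*-monoˡ-≤-nonNeg p {{nonNegative 0≤p}} p≤q)
    (*-monoʳ-≤-nonNeg q {{nonNegative (≤-trans 0≤p p≤q)}} p≤q)

  square-mono-< : ∀ {p q} → 0ℚ ≤ p → p < q → p * p < q * q
  square-mono-< {p} {q} 0≤p p<q = ≤-<-trans
    (*-monoˡ-≤-nonNeg p {{nonNegative 0≤p}} (<⇒≤ p<q))
    (*-monoˡ-<-pos q {{positive (≤-<-trans 0≤p p<q)}} p<q)

  -- q ↦ c - (q + b) is the reflection by which Lower (c ⊖ √ D ⊝ b) is read off Upper (√ D).
  reflect : ∀ c b q → c - ((c - (q + b)) + b) ≡ q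
  reflect = solve 3 (λ c b q → c :- ((c :- (q :+ b)) :+ b) := q) refl

  reflect-mono-≤ : ∀ c b {p q} → p ≤ q → c - (q + b) ≤ c - (p + b)
  reflect-mono-≤ c b p≤q = +-monoʳ-≤ c (neg-antimono-≤ (+-monoˡ-≤ b p≤q))

  reflect-mono-< : ∀ c b {p q} → p < q → c - (q + b) < c - (p + b)
  reflect-mono-< c b p<q = +-monoʳ-< c (neg-antimono-< (+-monoˡ-< b p<q))

  -- `L` lies above or below `rhs` as `u` lies below or above the root of `D`; `h` is a rational
  -- against which both are measured.
  module Root (c b L D h : ℚ) where

    private
      u = c - (L + b)
      rhs = c ⊖ √ D ⊝ b

    -- A `q` below `rhs` has its reflection t = c - (q + b) above the root. If `q` were not below
    -- `L`, then t ≤ u ≤ h, and the square of t would be at most `D`.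
    ≥-root : u ≤ h → h * h ≤ D → fromℚ L ≥ᵣ rhs
    ≥-root u≤h hh≤D q (0<t , D<tt) with q <? L
    ... | yes q<L = q<L
    ... | no q≮L  = contradiction (<-≤-trans D<tt (≤-trans (square-mono-≤ (<⇒≤ 0<t) t≤h) hh≤D)) (<-irrefl refl)
      where
      t≤h = ≤-trans (reflect-mono-≤ c b (≮⇒≥ q≮L)) u≤h

    private
      -- The reflection of `t` is below `L`, hence below `rhs`, which places `t` above the root.
      upper : fromℚ L ≤ᵣ rhs → ∀ {t} → u < t → Upper (√ D) t
      upper L≤ {t} u<t = subst (Upper (√ D)) (reflect c b t)
        (L≤ (c - (t + b)) (subst (c - (t + b) <_) (reflect c b L) (reflect-mono-< c b u<t)))

    -- A rational t strictly between `u` and `h` would lie above the root, giving D < t * t < h * h.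
    ≤-root⇒h≤u : h * h ≤ D → fromℚ L ≤ᵣ rhs → ¬ (u < h)
    ≤-root⇒h≤u hh≤D L≤ u<h =
      let t , u<t , t<h = <-dense u<h
          0<t , D<tt    = upper L≤ u<t
      in <-irrefl refl (<-trans D<tt (<-≤-trans (square-mono-< (<⇒≤ 0<t) t<h) hh≤D))

    -- If `h` were below the root, so would be some r > h, as the lower cut is open; but r > u lies
    -- above the root.
    ≤-root⇒D≤hh : u ≤ h → fromℚ L ≤ᵣ rhs → ¬ (h * h < D)
    ≤-root⇒D≤hh u≤h L≤ hh<D =
      let r , h<r , lower-r = lower-open (√ D) (inj₂ hh<D)
      in disjoint (√ D) lower-r (upper L≤ (≤-<-trans u≤h h<r))

    -- Since `h` is not negative, the reflection of `q`, which exceeds `h`, is positive and has the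
    -- larger square.
    ≤-root : 0ℚ ≤ h → h ≤ u → D ≤ h * h → fromℚ L ≤ᵣ rhs
    ≤-root 0≤h h≤u D≤hh q q<L = ≤-<-trans 0≤h h<t , ≤-<-trans D≤hh (square-mono-< 0≤h h<t)
      where
      h<t = ≤-<-trans h≤u (reflect-mono-< c b q<L)

  -- Equality in the theorem says u = √ D, while the two bounds say u ≤ h and
  -- h * h ≤ D.
  module Thresholds (n m s a : ℕ) where

    c D h L u : ℚ
    c = fromℤ (+ 4 ℤ.* + n ℤ.- + 2 ℤ.* + m)
    D = fromℤ (+ n ℤ.* (+ n ℤ.- + 1) ℤ.- + 2 ℤ.* + m) + + 1 / 4
    h = ι a - ½
    L = ι (s ℕ.+ a)
    u = c - (L + + 5 / 2)

    private
      rankLhs rankRhs alphaLhs alphaRhs : ℕ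
      rankLhs  = 4 ℕ.* n
      rankRhs  = s ℕ.+ 2 ℕ.* a ℕ.+ 2 ℕ.* m ℕ.+ 2
      alphaLhs = 2 ℕ.* m ℕ.+ a ℕ.* a ℕ.+ n
      alphaRhs = n ℕ.* n ℕ.+ a

      -- Adding `k₁` to both sides of the rank bound gives `u` and `h`; adding `k₂` to both sides of
      -- the bound on α gives `h * h` and `D`, because α(α - 1) + 1/4 is the square of α - 1/2.
      k₁ k₂ : ℚ
      k₁ = - (ι 2 * ι m + (ι s + ι a) + + 5 / 2)
      k₂ = + 1 / 4 - ι 2 * ι m - ι n - ι a

      u≡ : ι rankLhs + k₁ ≡ u
      u≡ = begin
        ι (4 ℕ.* n) + k₁
          ≡⟨ cong (_+ k₁) (ι-* 4 n) ⟩
        ι 4 * ι n + k₁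
          ≡⟨ solve 4 (λ n m s a → con (ι 4) :* n :+ :- (con (ι 2) :* m :+ (s :+ a) :+ con (+ 5 / 2))
                := (con (ι 4) :* n :- con (ι 2) :* m) :- ((s :+ a) :+ con (+ 5 / 2))) refl (ι n) (ι m) (ι s) (ι a) ⟩
        (ι 4 * ι n - ι 2 * ι m) - ((ι s + ι a) + + 5 / 2)
          ≡⟨ cong₂ (λ x y → x - (y + + 5 / 2))
               (trans (fromℤ-- (+ 4 ℤ.* + n) (+ 2 ℤ.* + m)) (cong₂ _-_ (fromℤ-* (+ 4) (+ n)) (fromℤ-* (+ 2) (+ m))))
               (ι-+ s a) ⟨
        u ∎
        where open ≡-Reasoning

      h≡ : ι rankRhs + k₁ ≡ h
      h≡ = begin
        ι rankRhs + k₁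
          ≡⟨ cong (_+ k₁) (trans (ι-+ (s ℕ.+ 2 ℕ.* a ℕ.+ 2 ℕ.* m) 2) (cong (_+ ι 2)
               (trans (ι-+ (s ℕ.+ 2 ℕ.* a) (2 ℕ.* m)) (cong₂ _+_
                 (trans (ι-+ s (2 ℕ.* a)) (cong (λ x → ι s + x) (ι-* 2 a))) (ι-* 2 m))))) ⟩
        ι s + ι 2 * ι a + ι 2 * ι m + ι 2 + k₁
          ≡⟨ solve 3 (λ m s a → s :+ con (ι 2) :* a :+ con (ι 2) :* m :+ con (ι 2)
                :+ :- (con (ι 2) :* m :+ (s :+ a) :+ con (+ 5 / 2))
                := a :- con ½) refl (ι m) (ι s) (ι a) ⟩
        h ∎
        where open ≡-Reasoning

      hh≡ : ι alphaLhs + k₂ ≡ h * h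
      hh≡ = begin
        ι alphaLhs + k₂
          ≡⟨ cong (_+ k₂) (trans (ι-+ (2 ℕ.* m ℕ.+ a ℕ.* a) n) (cong (_+ ι n)
               (trans (ι-+ (2 ℕ.* m) (a ℕ.* a)) (cong₂ _+_ (ι-* 2 m) (ι-* a a))))) ⟩
        ι 2 * ι m + ι a * ι a + ι n + k₂
          ≡⟨ solve 3 (λ n m a → con (ι 2) :* m :+ a :* a :+ n
                :+ (con (+ 1 / 4) :- con (ι 2) :* m :- n :- a)
                := (a :- con ½) :* (a :- con ½)) refl (ι n) (ι m) (ι a) ⟩
        h * h ∎
        where open ≡-Reasoning

      D≡ : ι alphaRhs + k₂ ≡ D
      D≡ = begin
        ι alphaRhs + k₂
          ≡⟨ cong (_+ k₂) (trans (ι-+ (n ℕ.* n) a) (cong (_+ ι a) (ι-* n n))) ⟩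
        ι n * ι n + ι a + k₂
          ≡⟨ solve 3 (λ n m a → n :* n :+ a :+ (con (+ 1 / 4) :- con (ι 2) :* m :- n :- a)
                := (n :* (n :- con (ι 1)) :- con (ι 2) :* m) :+ con (+ 1 / 4)) refl (ι n) (ι m) (ι a) ⟩
        (ι n * (ι n - ι 1) - ι 2 * ι m) + + 1 / 4
          ≡⟨ cong (_+ + 1 / 4) (trans (fromℤ-- (+ n ℤ.* (+ n ℤ.- + 1)) (+ 2 ℤ.* + m)) (cong₂ _-_
               (trans (fromℤ-* (+ n) (+ n ℤ.- + 1)) (cong (ι n *_) (fromℤ-- (+ n) (+ 1))))
               (fromℤ-* (+ 2) (+ m)))) ⟨
        D ∎
        where open ≡-Reasoning

    u≤h : rankLhs ℕ.≤ rankRhs → u ≤ h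
    u≤h le = subst₂ _≤_ u≡ h≡ (+-monoˡ-≤ k₁ (ι-mono-≤ le))

    u<h : rankLhs ℕ.< rankRhs → u < h
    u<h lt = subst₂ _<_ u≡ h≡ (+-monoˡ-< k₁ (ι-mono-< lt))

    u≡h : rankLhs ≡ rankRhs → u ≡ h
    u≡h eq = trans (sym u≡) (trans (cong (λ k → ι k + k₁) eq) h≡)

    hh≤D : alphaLhs ℕ.≤ alphaRhs → h * h ≤ D
    hh≤D le = subst₂ _≤_ hh≡ D≡ (+-monoˡ-≤ k₂ (ι-mono-≤ le))

    hh<D : alphaLhs ℕ.< alphaRhs → h * h < D
    hh<D lt = subst₂ _<_ hh≡ D≡ (+-monoˡ-< k₂ (ι-mono-< lt))

    hh≡D : alphaLhs ≡ alphaRhs → h * h ≡ D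
    hh≡D eq = trans (sym hh≡) (trans (cong (λ k → ι k + k₂) eq) D≡)

    0≤h : 1 ℕ.≤ a → 0ℚ ≤ h
    0≤h 1≤a = ≤-trans (nonNegative⁻¹ ½) (+-monoˡ-≤ (- ½) (ι-mono-≤ 1≤a))

    open Root c (+ 5 / 2) L D h

    ≥-from-bounds : rankLhs ℕ.≤ rankRhs → alphaLhs ℕ.≤ alphaRhs → fromℚ L ≥ᵣ (c ⊖ √ D ⊝ + 5 / 2)
    ≥-from-bounds le₁ le₂ = ≥-root (u≤h le₁) (hh≤D le₂)

    -- A strict rank bound gives u < h ≤ √D, a strict bound on α gives u ≤ h < √D, and either
    -- contradicts √D ≤ u.
    ≤⇒tight : rankLhs ℕ.≤ rankRhs → alphaLhs ℕ.≤ alphaRhs → fromℚ L ≤ᵣ (c ⊖ √ D ⊝ + 5 / 2) →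
              alphaLhs ≡ alphaRhs × rankLhs ≡ rankRhs
    ≤⇒tight le₁ le₂ L≤ with ℕ.m≤n⇒m<n∨m≡n le₁ | ℕ.m≤n⇒m<n∨m≡n le₂
    ... | inj₁ lt | _       = contradiction (u<h lt) (≤-root⇒h≤u (hh≤D le₂) L≤)
    ... | inj₂ _  | inj₁ lt = contradiction (hh<D lt) (≤-root⇒D≤hh (u≤h le₁) L≤)
    ... | inj₂ eq₁ | inj₂ eq₂ = eq₂ , eq₁

    tight⇒≤ : 1 ℕ.≤ a → alphaLhs ≡ alphaRhs → rankLhs ≡ rankRhs → fromℚ L ≤ᵣ (c ⊖ √ D ⊝ + 5 / 2)
    tight⇒≤ 1≤a eq₂ eq₁ = ≤-root (0≤h 1≤a) (≤-reflexive (sym (u≡h eq₁))) (≤-reflexive (sym (hh≡D eq₂)))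

open Tightness
open Reals

-- The inequality and its equality case assembled from the two bounds.

open import Data.Nat.Base using (ℕ; _+_)
open import Data.Integer.Base using (+_; _*_; _-_)
open import Data.Rational.Base using (_/_) renaming (_+_ to _+ℚ_)

theorem1p4 : ∀ {n} (G : Graph n) (σ : Orientation G) → Connected G →
    let m   = edgeCount G
        lhs = fromℚ (fromℤ (+ (sr σ + α G)))
        rhs = fromℤ (+ 4 * + n - + 2 * + m) ⊖ √ (fromℤ (+ n * (+ n - + 1) - + 2 * + m) +ℚ + 1 / 4) ⊝ + 5 / 2
    in (lhs ≥ᵣ rhs) × (lhs ≃ᵣ rhs ⇔ (G ≅ star n ⊎ G ≅ C₃))
theorem1p4 {n} G σ conn = lower , mk⇔ to from
  where
  open Thresholds n (edgeCount G) (sr σ) (α G)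
  bound-sr = sr+2α-bound σ conn
  bound-α  = α-bound G
  lower = ≥-from-bounds bound-sr bound-α

  to : fromℚ L ≃ᵣ (c ⊖ √ D ⊝ + 5 / 2) → G ≅ star n ⊎ G ≅ C₃
  to (lhs≤rhs , _) = let tα , tr = ≤⇒tight bound-sr bound-α lhs≤rhs in tight⇒≅ σ conn tα tr

  from : G ≅ star n ⊎ G ≅ C₃ → fromℚ L ≃ᵣ (c ⊖ √ D ⊝ + 5 / 2)
  from (inj₁ iso) = let tα , tr = star⇒tight σ conn iso in tight⇒≤ (1≤α G (proj₁ conn)) tα tr , lower
  from (inj₂ iso) = let tα , tr = C₃⇒tight σ conn iso in tight⇒≤ (1≤α G (proj₁ conn)) tα tr , lower
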